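{- We have $$A^{1234}(x,q)=1+I^{1234}(x,q)+\frac{x}{1-xq}\left(A^{123}(x,q)-1\right)+\frac{x}{1-xq}\left(I^{123}(x,q)-\frac{x}{1-xq}\right).$$ Also, $$I^{1234}(x)=E(x)-\frac{2x}{1-x}C(x)+\frac{x^3}{(1-x)^3}+\frac{x^2}{(1-x)^2}+\frac{2x}{1-x}-1.$$ Moreover, $I^{1234}_1=1$ and for $n\ge2$, $$I^{1234}_n=E_n-2\sum_{i=0}^{n-1}C_i+\frac12\left(n^2-n+4\right),$$ where $C_m=\frac1{m+1}\binom{2m}m$ is the $m$-th Catalan number, $C(x)=\sum_{m\ge0}C_mx^m=\frac{1-\sqrt{1-4x}}{2x}$, $E_m$ is the number of $1234$-avoiding permutations of $[m]$ ($E_0=1$) and $E(x)=\sum_{m\ge0}E_mx^m$.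
   Context: For a permutation $\pi=\pi_1\cdots\pi_n$ of $[n]$, let $i_\pi$ be the smallest index $i$ with $\{\pi_1,\dots,\pi_i\}=\{1,\dots,i\}$; $\pi$ is indecomposable if $i_\pi=n$ (the empty permutation is not indecomposable). A permutation $\pi$ avoids a pattern $\tau\in\mathfrak S_k$ if no subsequence $\pi_{j_1}\cdots\pi_{j_k}$ ($j_1<\cdots<j_k$) is order-isomorphic to $\tau$. A descent of $\pi$ is an index $i$ with $\pi_i>\pi_{i+1}$. For a pattern $\sigma$, $A^\sigma_{n,i}$ (resp. $I^\sigma_{n,i}$) is the number of $\sigma$-avoiding permutations (resp. $\sigma$-avoiding indecomposable permutations) of $[n]$ with $i$ descents; $A^\sigma(x,q)=1+\sum_{n\ge1}\sum_iA^\sigma_{n,i}x^nq^i$, $I^\sigma(x,q)=\sum_{n\ge1}\sum_iI^\sigma_{n,i}x^nq^i$, $I^\sigma(x)=I^\sigma(x,1)=\sum_{n\ge1}I^\sigma_nx^n$. -}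

module Defs where

open import Data.Nat as ℕ using (ℕ; zero; suc; _∸_; _≡ᵇ_; _<ᵇ_; _≤ᵇ_; _/_)
open import Data.Nat.Combinatorics using (_C_)
open import Data.Bool using (Bool; true; false; _∧_; not; if_then_else_)
open import Data.List using (List; []; _∷_; filterᵇ; map; concatMap; _++_; take; length; upTo)
open import Data.Integer as ℤ using (ℤ; +_)

beq : Bool → Bool → Bool
beq true  b = b
beq false b = not b

memb : ℕ → List ℕ → Bool
memb v []       = false
memb v (x ∷ xs) = if v ≡ᵇ x then true else memb v xs

allL : {A : Set} → (A → Bool) → List A → Bool
allL p []       = true
allL p (x ∷ xs) = p x ∧ allL p xs

anyL : {A : Set} → (A → Bool) → List A → Bool
anyL p []       = false
anyL p (x ∷ xs) = if p x then true else anyL p xs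

count : {A : Set} → (A → Bool) → List A → ℕ
count p []       = 0
count p (x ∷ xs) = if p x then suc (count p xs) else count p xs

range1 : ℕ → List ℕ
range1 n = map suc (upTo n)

words : ℕ → ℕ → List (List ℕ)
words zero    n = [] ∷ []
words (suc k) n = concatMap (λ a → map (a ∷_) (words k n)) (range1 n)

-- a word of length n over [n] is a permutation iff it contains every value of [n]
isPermOf : ℕ → List ℕ → Bool
isPermOf n w = allL (λ v → memb v w) (range1 n)

perms : ℕ → List (List ℕ)
perms n = filterᵇ (isPermOf n) (words n n)

subseqs : ℕ → List ℕ → List (List ℕ)
subseqs zero    _        = [] ∷ []
subseqs (suc k) []       = []
subseqs (suc k) (x ∷ xs) = map (x ∷_) (subseqs k xs) ++ subseqs (suc k) xs

pairsOK : ℕ → List ℕ → ℕ → List ℕ → Bool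
pairsOK a []        b []        = true
pairsOK a (a' ∷ as) b (b' ∷ bs) =
  beq (a <ᵇ a') (b <ᵇ b') ∧ beq (a' <ᵇ a) (b' <ᵇ b) ∧ pairsOK a as b bs
pairsOK _ _ _ _ = false

orderIso : List ℕ → List ℕ → Bool
orderIso []       []       = true
orderIso (a ∷ as) (b ∷ bs) = pairsOK a as b bs ∧ orderIso as bs
orderIso _        _        = false

contains : List ℕ → List ℕ → Bool
contains π τ = anyL (orderIso τ) (subseqs (length τ) π)

avoids : List ℕ → List ℕ → Bool
avoids π τ = not (contains π τ)

des : List ℕ → ℕ
des (a ∷ b ∷ rest) = (if b <ᵇ a then 1 else 0) ℕ.+ des (b ∷ rest)
des _              = 0

isBlock : List ℕ → ℕ → Bool
isBlock π i = allL (λ v → memb v (take i π)) (range1 i)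
            ∧ allL (λ v → memb v (range1 i)) (take i π)

firstTrue : (ℕ → Bool) → List ℕ → ℕ
firstTrue p []       = 0
firstTrue p (x ∷ xs) = if p x then x else firstTrue p xs

iπ : List ℕ → ℕ
iπ π = firstTrue (isBlock π) (range1 (length π))

indec : List ℕ → Bool
indec []      = false
indec (x ∷ π) = iπ (x ∷ π) ≡ᵇ length (x ∷ π)

p123 : List ℕ
p123 = 1 ∷ 2 ∷ 3 ∷ []

p1234 : List ℕ
p1234 = 1 ∷ 2 ∷ 3 ∷ 4 ∷ []

Acnt : List ℕ → ℕ → ℕ → ℕ
Acnt σ n i = count (λ π → avoids π σ ∧ (des π ≡ᵇ i)) (perms n)

Icnt : List ℕ → ℕ → ℕ → ℕ
Icnt σ n i = count (λ π → avoids π σ ∧ indec π ∧ (des π ≡ᵇ i)) (perms n)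

Icnt1 : List ℕ → ℕ → ℕ
Icnt1 σ n = count (λ π → avoids π σ ∧ indec π) (perms n)

E : ℕ → ℕ
E m = count (λ π → avoids π p1234) (perms m)

catalan : ℕ → ℕ
catalan m = ((2 ℕ.* m) C m) / suc m

sumTo : (ℕ → ℤ) → ℕ → ℤ
sumTo f zero    = f 0
sumTo f (suc n) = sumTo f n ℤ.+ f (suc n)

sumBelow : (ℕ → ℕ) → ℕ → ℕ
sumBelow f zero    = 0
sumBelow f (suc n) = sumBelow f n ℕ.+ f n

-- univariate series in x: coefficient of x^n
Ser1 : Set
Ser1 = ℕ → ℤ

infixl 6 _⊕_ _⊖_
infixl 7 _⊛_

_⊕_ : Ser1 → Ser1 → Ser1
(f ⊕ g) n = f n ℤ.+ g n

_⊖_ : Ser1 → Ser1 → Ser1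
(f ⊖ g) n = f n ℤ.- g n

_⊛_ : Ser1 → Ser1 → Ser1
(f ⊛ g) n = sumTo (λ a → f a ℤ.* g (n ∸ a)) n

scal : ℤ → Ser1 → Ser1
scal c f n = c ℤ.* f n

one1 : Ser1
one1 zero    = + 1
one1 (suc n) = + 0

-- x/(1-x) = Σ_{n≥1} x^n
gx : Ser1
gx zero    = + 0
gx (suc n) = + 1

Eser : Ser1
Eser m = + E m

Cser : Ser1
Cser m = + catalan m

Iser1 : List ℕ → Ser1
Iser1 σ zero    = + 0
Iser1 σ (suc n) = + Icnt1 σ (suc n)

-- bivariate series in x,q: coefficient of x^n q^i
Ser2 : Set
Ser2 = ℕ → ℕ → ℤ

infixl 6 _⊕₂_ _⊖₂_
infixl 7 _⊛₂_

_⊕₂_ : Ser2 → Ser2 → Ser2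
(f ⊕₂ g) n i = f n i ℤ.+ g n i

_⊖₂_ : Ser2 → Ser2 → Ser2
(f ⊖₂ g) n i = f n i ℤ.- g n i

_⊛₂_ : Ser2 → Ser2 → Ser2
(f ⊛₂ g) n i = sumTo (λ a → sumTo (λ b → f a b ℤ.* g (n ∸ a) (i ∸ b)) i) n

one2 : Ser2
one2 zero zero    = + 1
one2 _    _       = + 0

-- x/(1-xq) = Σ_{n≥1} x^n q^{n-1}
gxq : Ser2
gxq zero    i = + 0
gxq (suc n) i = if n ≡ᵇ i then + 1 else + 0

Aser2 : List ℕ → Ser2
Aser2 σ zero    i = one2 zero i
Aser2 σ (suc n) i = + Acnt σ (suc n) i

Iser2 : List ℕ → Ser2
Iser2 σ zero    i = + 0
Iser2 σ (suc n) i = + Icnt σ (suc n) i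

{-# OPTIONS --safe #-}
module Submission where

-- Write a decomposable permutation as α ⊕ β with α its indecomposable first block and β nonempty. The longest
-- increasing subsequences of α and β add up, so α ⊕ β avoids 1234 exactly when α is decreasing and β avoids 123,
-- or α avoids 123 but is not decreasing and β is decreasing; descents add up too. This gives the bivariate
-- identity. The same analysis for 123 shows that the indecomposable avoiders of 123 of size n number C_n - (n - 1),
-- since the decomposable ones are the sums of two decreasing words, and the remaining formulas follow from the
-- Catalan count of the avoiders of 123.
--
-- For that count, let b(n,k) be the number of avoiders of 123 in which every pair u < v occurring in this order has
-- u ≤ k. Deleting the first letter from those of size n + 1 whose largest such u is k + 1 leaves a word of the same
-- kind of size n (if the letter is n + 1), or any word counted by b(n,k) (if the letter is k + 1, the only other
-- possibility). This is the recurrence of Catalan's triangle, and b(n,n) = C_n.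

open import Defs
open import Data.Bool using (Bool; true; false; if_then_else_; T; _∧_; not)
open import Data.Bool.Properties using (not-injective; ∧-identityʳ; ∧-zeroʳ)
open import Data.Empty using (⊥; ⊥-elim)
open import Data.List using (List; []; _∷_; _++_; _∷ʳ_; length; null; map; filterᵇ; take; drop; upTo; cartesianProductWith; concatMap)
open import Data.List.Properties using (∷-injective; ∷-injectiveʳ; map-injective; length-++; length-map; ++-identityʳ; ++-assoc; ++-cancelˡ; ++-cancelʳ; length-upTo; upTo-∷ʳ; map-++; length-take; take++drop≡id)
open import Data.List.Membership.Propositional using (_∈_)
open import Data.List.Membership.Propositional.Properties
open import Data.List.Relation.Unary.Any using (here; there)
open import Data.List.Relation.Unary.All as All using (All; []; _∷_)
open import Data.List.Relation.Unary.AllPairs using (AllPairs; []; _∷_)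
open import Data.List.Relation.Unary.Unique.Propositional using (Unique)
import Data.List.Relation.Unary.Unique.Propositional.Properties as Unique
open import Data.List.Relation.Binary.Permutation.Propositional using (_↭_; ↭-sym; ↭-trans; ↭-refl; prep; ↭⇒↭ₛ)
open import Data.List.Relation.Binary.Permutation.Propositional.Properties using (shift; ↭-length; ∈-resp-↭; drop-∷; ∷↭∷ʳ; ↭-map-inv; ↭-empty-inv; ++⁺; map⁺)
import Data.List.Relation.Binary.Permutation.Setoid.Properties as ↭ₛ
open import Data.Nat
open import Data.Nat.Combinatorics using (_C_; nC1≡n; nCk≡nC[n∸k]; nCk+nC[k+1]≡[n+1]C[k+1])
open import Data.Nat.DivMod using (m*n/n≡m)
open import Data.Nat.Properties
open import Data.Nat.Tactic.RingSolver using (solve-∀)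
open import Data.Product hiding (map)
open import Data.Sum using (_⊎_; inj₁; inj₂)
open import Data.Unit using (tt)
open import Function using (_∘_; id)
open import Relation.Binary.Definitions using (tri<; tri≈; tri>)
open import Relation.Binary.PropositionalEquality
open import Relation.Nullary

-- Finite cardinalities

-- Induction on `xs`: cut the head out of `ys` at one of its occurrences. Uniqueness keeps the head
-- out of the tail, so the tail still lies in what remains of `ys`.
complement : {A : Set} {xs ys : List A} → Unique xs → (∀ {x} → x ∈ xs → x ∈ ys) →
  ∃ λ zs → xs ++ zs ↭ ys
complement {ys = ys} [] _ = ys , ↭-refl
complement {xs = x ∷ xs} (x∉xs ∷ u) sub with ∈-∃++ (sub (here refl))
... | as , bs , refl with complement {ys = as ++ bs} u sub′
  where
  sub′ : ∀ {y} → y ∈ xs → y ∈ as ++ bs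
  sub′ y∈ with ∈-resp-↭ (shift x as bs) (sub (there y∈))
  ... | here refl = ⊥-elim (All.lookup x∉xs y∈ refl)
  ... | there y∈′ = y∈′
... | zs , p = zs , ↭-trans (prep x p) (↭-sym (shift x as bs))

-- The complement of `xs` in `ys` must be empty, since one leftover element would already make `ys`
-- too long.
pigeonhole : {A : Set} {xs ys : List A} → Unique xs → (∀ {x} → x ∈ xs → x ∈ ys) →
  length ys ≤ length xs → xs ↭ ys
pigeonhole {xs = xs} {ys} u sub le with complement u sub
... | [] , p = subst (_↭ _) (++-identityʳ xs) p
... | z ∷ zs , p = ⊥-elim (<-irrefl refl (begin-strict
    length xs                 <⟨ m<m+n (length xs) z<s ⟩
    length xs + length (z ∷ zs) ≡⟨ length-++ xs ⟨
    length (xs ++ z ∷ zs)     ≡⟨ ↭-length p ⟩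
    length ys                 ≤⟨ le ⟩
    length xs                 ∎))
  where open ≤-Reasoning

unique-⊆-length : {A : Set} {xs ys : List A} → Unique xs → (∀ {x} → x ∈ xs → x ∈ ys) →
  length xs ≤ length ys
unique-⊆-length {xs = xs} u sub with complement u sub
... | zs , p = ≤-trans (m≤m+n (length xs) (length zs))
                 (≤-reflexive (trans (sym (length-++ xs)) (↭-length p)))

-- Cardinality is witnessed by a repetition-free enumeration. The counting identities below arise by
-- enumerating one predicate in two ways and applying `card-unique`.
record Card {A : Set} (P : A → Set) (n : ℕ) : Set where
  constructor mkCard
  field
    elements : List A
    unique   : Unique elements
    sound    : ∀ {x} → x ∈ elements → P x
    complete : ∀ {x} → P x → x ∈ elements
    size     : length elements ≡ n
open Card

module _ {A : Set} where

  card-unique : {P : A → Set} {m n : ℕ} → Card P m → Card P n → m ≡ n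
  card-unique c d = trans (sym (size c)) (trans (≤-antisym
    (unique-⊆-length (unique c) (complete d ∘ sound c))
    (unique-⊆-length (unique d) (complete c ∘ sound d))) (size d))

  card-cong : {P Q : A → Set} {n : ℕ} → (∀ {x} → P x → Q x) → (∀ {x} → Q x → P x) →
    Card P n → Card Q n
  card-cong f g c = mkCard (elements c) (unique c) (f ∘ sound c) (complete c ∘ g) (size c)

  card-⊎ : {P Q : A → Set} {m n : ℕ} → (∀ {x} → P x → Q x → ⊥) →
    Card P m → Card Q n → Card (λ x → P x ⊎ Q x) (m + n)
  card-⊎ disj c d = mkCard (elements c ++ elements d)
    (Unique.++⁺ (unique c) (unique d) (λ (x∈c , x∈d) → disj (sound c x∈c) (sound d x∈d)))
    split
    (λ { (inj₁ p) → ∈-++⁺ˡ (complete c p) ; (inj₂ q) → ∈-++⁺ʳ (elements c) (complete d q) })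
    (trans (length-++ (elements c)) (cong₂ _+_ (size c) (size d)))
    where
    split : ∀ {x} → x ∈ elements c ++ elements d → _ ⊎ _
    split x∈ with ∈-++⁻ (elements c) x∈
    ... | inj₁ p = inj₁ (sound c p)
    ... | inj₂ q = inj₂ (sound d q)

  card-empty : {P : A → Set} → (∀ {x} → ¬ P x) → Card P 0
  card-empty e = mkCard [] [] (λ ()) (⊥-elim ∘ e) refl

  card-singleton : {P : A → Set} (a : A) → P a → (∀ {x} → P x → x ≡ a) → Card P 1
  card-singleton a pa only = mkCard (a ∷ []) ([] ∷ [])
    (λ { (here refl) → pa }) (here ∘ only) refl

  card-Σ : {P : ℕ → A → Set} {f : ℕ → ℕ} (m : ℕ) →
    (∀ {i j x} → i < m → j < m → P i x → P j x → i ≡ j) →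
    (∀ i → i < m → Card (P i) (f i)) →
    Card (λ x → ∃ λ i → i < m × P i x) (sumBelow f m)
  card-Σ zero disj c = card-empty λ ()
  card-Σ {P} (suc m) disj c = card-cong merge split
    (card-⊎ (λ { (i , i<m , p) q → <-irrefl (disj (m<n⇒m<1+n i<m) ≤-refl p q) i<m })
      (card-Σ m (λ i<m j<m → disj (m<n⇒m<1+n i<m) (m<n⇒m<1+n j<m)) (λ i i<m → c i (m<n⇒m<1+n i<m))) (c m ≤-refl))
    where
    merge : ∀ {x} → _ → ∃ λ i → i < suc m × P i x
    merge (inj₁ (i , i<m , p)) = i , m<n⇒m<1+n i<m , p
    merge (inj₂ p) = m , ≤-refl , p
    split : ∀ {x} → (∃ λ i → i < suc m × P i x) → _
    split (i , s≤s i≤m , p) with m≤n⇒m<n∨m≡n i≤m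
    ... | inj₁ i<m = inj₁ (i , i<m , p)
    ... | inj₂ refl = inj₂ p

  card-image : {B : Set} {P : A → Set} {n : ℕ} (f : A → B) → (∀ {x y} → f x ≡ f y → x ≡ y) →
    Card P n → Card (λ y → ∃ λ x → P x × y ≡ f x) n
  card-image f inj c = mkCard (map f (elements c)) (Unique.map⁺ inj (unique c))
    (λ y∈ → let (x , x∈ , eq) = ∈-map⁻ f y∈ in x , sound c x∈ , eq)
    (λ { (x , p , refl) → ∈-map⁺ f (complete c p) })
    (trans (length-map f (elements c)) (size c))

  ∈-filterᵇ⁻ : (p : A → Bool) {x : A} (xs : List A) → x ∈ filterᵇ p xs → x ∈ xs × p x ≡ true
  ∈-filterᵇ⁻ p (y ∷ xs) x∈ with p y in eq
  ∈-filterᵇ⁻ p (y ∷ xs) (here refl) | true = here refl , eq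
  ∈-filterᵇ⁻ p (y ∷ xs) (there x∈) | true = map₁ there (∈-filterᵇ⁻ p xs x∈)
  ∈-filterᵇ⁻ p (y ∷ xs) x∈ | false = map₁ there (∈-filterᵇ⁻ p xs x∈)

  ∈-filterᵇ⁺ : (p : A → Bool) {x : A} {xs : List A} → x ∈ xs → p x ≡ true → x ∈ filterᵇ p xs
  ∈-filterᵇ⁺ p {xs = y ∷ xs} x∈ px with p y in eq
  ∈-filterᵇ⁺ p (here refl) px | true = here refl
  ∈-filterᵇ⁺ p (there x∈) px | true = there (∈-filterᵇ⁺ p x∈ px)
  ∈-filterᵇ⁺ p (here refl) px | false with () ← trans (sym eq) px
  ∈-filterᵇ⁺ p (there x∈) px | false = ∈-filterᵇ⁺ p x∈ px

  unique-filterᵇ : (p : A → Bool) {xs : List A} → Unique xs → Unique (filterᵇ p xs)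
  unique-filterᵇ p [] = []
  unique-filterᵇ p {x ∷ xs} (x∉ ∷ u) with p x
  ... | true  = All.tabulate (λ y∈ → All.lookup x∉ (proj₁ (∈-filterᵇ⁻ p xs y∈))) ∷ unique-filterᵇ p u
  ... | false = unique-filterᵇ p u

  length-filterᵇ : (p : A → Bool) (xs : List A) → length (filterᵇ p xs) ≡ count p xs
  length-filterᵇ p [] = refl
  length-filterᵇ p (x ∷ xs) with p x
  ... | true  = cong suc (length-filterᵇ p xs)
  ... | false = length-filterᵇ p xs

  card-filter : {P : A → Set} {n : ℕ} (c : Card P n) (p : A → Bool) →
    Card (λ x → P x × p x ≡ true) (count p (elements c))
  card-filter c p = mkCard (filterᵇ p (elements c)) (unique-filterᵇ p (unique c))
    (λ x∈ → map₁ (sound c) (∈-filterᵇ⁻ p _ x∈))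
    (λ (Px , px) → ∈-filterᵇ⁺ p (complete c Px) px)
    (length-filterᵇ p (elements c))

-- Permutations of [n] as words

unique-resp-↭ : {A : Set} {xs ys : List A} → xs ↭ ys → Unique xs → Unique ys
unique-resp-↭ {A} p = ↭ₛ.Unique-resp-↭ (setoid A) (↭⇒↭ₛ p)

∈-range1⁺ : ∀ {v n} → 1 ≤ v → v ≤ n → v ∈ range1 n
∈-range1⁺ {suc v} _ v<n = ∈-map⁺ suc (∈-upTo⁺ v<n)

∈-range1⁻ : ∀ {v n} → v ∈ range1 n → 1 ≤ v × v ≤ n
∈-range1⁻ v∈ with ∈-map⁻ suc v∈
... | u , u∈ , refl = s≤s z≤n , ∈-upTo⁻ u∈

range1-unique : ∀ n → Unique (range1 n)
range1-unique n = Unique.map⁺ suc-injective (Unique.upTo⁺ n)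

range1-length : ∀ n → length (range1 n) ≡ n
range1-length n = trans (length-map suc (upTo n)) (length-upTo n)

range1-∷ʳ : ∀ n → range1 (suc n) ≡ range1 n ∷ʳ suc n
range1-∷ʳ n = trans (cong (map suc) (sym (upTo-∷ʳ n))) (map-++ suc (upTo n) (n ∷ []))

-- With this form, deleting a letter, cancelling a prefix and pulling back a relabelling are
-- operations on `↭`.
Perm : ℕ → List ℕ → Set
Perm n w = w ↭ range1 n

module _ {n : ℕ} {w : List ℕ} (p : Perm n w) where

  perm-length : length w ≡ n
  perm-length = trans (↭-length p) (range1-length n)

  perm-unique : Unique w
  perm-unique = unique-resp-↭ (↭-sym p) (range1-unique n)

  perm-bounds : ∀ {v} → v ∈ w → 1 ≤ v × v ≤ n
  perm-bounds = ∈-range1⁻ ∘ ∈-resp-↭ p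

  perm-∈ : ∀ {v} → 1 ≤ v → v ≤ n → v ∈ w
  perm-∈ 1≤v v≤n = ∈-resp-↭ (↭-sym p) (∈-range1⁺ 1≤v v≤n)

perm-intro : ∀ {n w} → Unique w → length w ≡ n → (∀ {v} → v ∈ w → 1 ≤ v × v ≤ n) → Perm n w
perm-intro {n} u len b = pigeonhole u (λ v∈ → let (1≤v , v≤n) = b v∈ in ∈-range1⁺ 1≤v v≤n)
  (≤-reflexive (trans (range1-length n) (sym len)))

-- Boolean tests, words and the enumeration of permutations.

T⇒≡ : ∀ {b} → T b → b ≡ true
T⇒≡ {true} _ = refl

≡⇒T : ∀ {b} → b ≡ true → T b
≡⇒T refl = tt

∧⁻ : ∀ {a b} → a ∧ b ≡ true → a ≡ true × b ≡ true
∧⁻ {true} eq = refl , eq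

∧⁺ : ∀ {a b} → a ≡ true → b ≡ true → a ∧ b ≡ true
∧⁺ refl eq = eq

≢true⇒≡false : ∀ {b} → ¬ (b ≡ true) → b ≡ false
≢true⇒≡false {true} ne = ⊥-elim (ne refl)
≢true⇒≡false {false} _ = refl

<ᵇ-true : ∀ {m n} → m < n → (m <ᵇ n) ≡ true
<ᵇ-true = T⇒≡ ∘ <⇒<ᵇ

<ᵇ-false : ∀ {m n} → ¬ (m < n) → (m <ᵇ n) ≡ false
<ᵇ-false ≮ = ≢true⇒≡false (≮ ∘ <ᵇ⇒< _ _ ∘ ≡⇒T)

memb⁻ : ∀ {v} xs → memb v xs ≡ true → v ∈ xs
memb⁻ {v} (x ∷ xs) eq with v ≡ᵇ x in e
... | true  = here (≡ᵇ⇒≡ v x (≡⇒T e))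
... | false = there (memb⁻ xs eq)

memb⁺ : ∀ {v xs} → v ∈ xs → memb v xs ≡ true
memb⁺ {v} (here refl) rewrite T⇒≡ (≡⇒≡ᵇ v v refl) = refl
memb⁺ {v} {x ∷ xs} (there v∈) with v ≡ᵇ x
... | true  = refl
... | false = memb⁺ v∈

module _ {A : Set} {p : A → Bool} where

  allL⁻ : ∀ {xs} → allL p xs ≡ true → ∀ {x} → x ∈ xs → p x ≡ true
  allL⁻ eq (here refl) = proj₁ (∧⁻ eq)
  allL⁻ eq (there x∈)  = allL⁻ (proj₂ (∧⁻ eq)) x∈

  allL⁺ : ∀ {xs} → (∀ {x} → x ∈ xs → p x ≡ true) → allL p xs ≡ true
  allL⁺ {[]} _ = refl
  allL⁺ {x ∷ xs} h = ∧⁺ (h (here refl)) (allL⁺ (h ∘ there))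

  anyL⁻ : ∀ xs → anyL p xs ≡ true → ∃ λ x → x ∈ xs × p x ≡ true
  anyL⁻ (x ∷ xs) eq with p x in e
  ... | true  = x , here refl , e
  ... | false with anyL⁻ xs eq
  ...   | y , y∈ , py = y , there y∈ , py

  anyL⁺ : ∀ {xs x} → x ∈ xs → p x ≡ true → anyL p xs ≡ true
  anyL⁺ (here refl) px rewrite px = refl
  anyL⁺ {y ∷ _} (there x∈) px with p y
  ... | true  = refl
  ... | false = anyL⁺ x∈ px

concatMap-∷ : (ws : List (List ℕ)) (xs : List ℕ) →
  concatMap (λ a → map (a ∷_) ws) xs ≡ cartesianProductWith _∷_ xs ws
concatMap-∷ ws [] = refl
concatMap-∷ ws (x ∷ xs) = cong (map (x ∷_) ws ++_) (concatMap-∷ ws xs)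

words-unique : ∀ k n → Unique (words k n)
words-unique zero n = [] ∷ []
words-unique (suc k) n = subst Unique (sym (concatMap-∷ (words k n) (range1 n)))
  (Unique.cartesianProductWith⁺ _∷_ (λ { refl → refl , refl }) (range1-unique n) (words-unique k n))

∈-words⁻ : ∀ k n {w} → w ∈ words k n → length w ≡ k × (∀ {v} → v ∈ w → v ∈ range1 n)
∈-words⁻ zero n (here refl) = refl , λ ()
∈-words⁻ (suc k) n w∈ with ∈-cartesianProductWith⁻ _∷_ (range1 n) (words k n)
  (subst (_ ∈_) (concatMap-∷ (words k n) (range1 n)) w∈)
... | a , w , a∈ , w∈′ , refl with ∈-words⁻ k n w∈′
... | len , sub = cong suc len , λ { (here refl) → a∈ ; (there v∈) → sub v∈ }

∈-words⁺ : ∀ n w → (∀ {v} → v ∈ w → v ∈ range1 n) → w ∈ words (length w) n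
∈-words⁺ n [] _ = here refl
∈-words⁺ n (x ∷ w) sub = subst (x ∷ w ∈_) (sym (concatMap-∷ (words (length w) n) (range1 n)))
  (∈-cartesianProductWith⁺ _∷_ (sub (here refl)) (∈-words⁺ n w (sub ∘ there)))

-- The test `isPermOf` puts every value of `range1 n` into `w`, and `w` has only n places for them,
-- so pigeonhole applies with `range1 n` as the smaller list.
∈-perms⁻ : ∀ n {w} → w ∈ perms n → Perm n w
∈-perms⁻ n w∈ with ∈-filterᵇ⁻ (isPermOf n) (words n n) w∈
... | w∈words , isp = ↭-sym (pigeonhole (range1-unique n) (λ v∈ → memb⁻ _ (allL⁻ isp v∈))
  (≤-reflexive (trans (proj₁ (∈-words⁻ n n w∈words)) (sym (range1-length n)))))

∈-perms⁺ : ∀ n {w} → Perm n w → w ∈ perms n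
∈-perms⁺ n {w} p = ∈-filterᵇ⁺ (isPermOf n)
  (subst (λ k → w ∈ words k n) (perm-length p) (∈-words⁺ n w (∈-resp-↭ p)))
  (allL⁺ (λ v∈ → memb⁺ (∈-resp-↭ (↭-sym p) v∈)))

card-perms : ∀ n (q : List ℕ → Bool) → Card (λ w → Perm n w × q w ≡ true) (count q (perms n))
card-perms n = card-filter (mkCard (perms n)
  (unique-filterᵇ (isPermOf n) (words-unique n n)) (∈-perms⁻ n) (∈-perms⁺ n) refl)

-- Increasing subsequences and avoidance

-- k is the length of the subsequence and l a lower bound for its entries
data Inc : ℕ → ℕ → List ℕ → Set where
  nil  : ∀ {l w} → Inc 0 l w
  pick : ∀ {k l x w} → l ≤ x → Inc k (suc x) w → Inc (suc k) l (x ∷ w)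
  skip : ∀ {k l x w} → Inc k l w → Inc k l (x ∷ w)

inc-weaken : ∀ {k l m w} → m ≤ l → Inc k l w → Inc k m w
inc-weaken m≤l nil = nil
inc-weaken m≤l (pick l≤x i) = pick (≤-trans m≤l l≤x) i
inc-weaken m≤l (skip i) = skip (inc-weaken m≤l i)

inc-shorten : ∀ {k l w} → Inc (suc k) l w → Inc k l w
inc-shorten {zero} i = nil
inc-shorten {suc k} (pick l≤x i) = pick l≤x (inc-shorten i)
inc-shorten {suc k} (skip i) = skip (inc-shorten i)

inc-≤ : ∀ {j k l w} → j ≤ k → Inc k l w → Inc j l w
inc-≤ z≤n i = nil
inc-≤ (s≤s j≤k) (pick l≤x i) = pick l≤x (inc-≤ j≤k i)
inc-≤ (s≤s j≤k) (skip i) = skip (inc-≤ (s≤s j≤k) i)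

inc-raise : ∀ {k l m w} → (∀ {v} → v ∈ w → m ≤ v) → Inc k l w → Inc k m w
inc-raise h nil = nil
inc-raise h (pick l≤x i) = pick (h (here refl)) i
inc-raise h (skip i) = skip (inc-raise (h ∘ there) i)

inc-1⁺ : ∀ {l v w} → v ∈ w → l ≤ v → Inc 1 l w
inc-1⁺ (here refl) l≤v = pick l≤v nil
inc-1⁺ (there v∈) l≤v = skip (inc-1⁺ v∈ l≤v)

inc-1⁻ : ∀ {k l w} → Inc (suc k) l w → ∃ λ v → v ∈ w × l ≤ v
inc-1⁻ (pick l≤x _) = _ , here refl , l≤x
inc-1⁻ (skip i) with inc-1⁻ i
... | v , v∈ , l≤v = v , there v∈ , l≤v

inc-map⁺ : ∀ {k l l′ w} {f : ℕ → ℕ} → (∀ {x y} → x < y → f x < f y) →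
  (∀ {y} → l ≤ y → l′ ≤ f y) → Inc k l w → Inc k l′ (map f w)
inc-map⁺ mono h nil = nil
inc-map⁺ mono h (pick l≤x i) = pick (h l≤x) (inc-map⁺ mono mono i)
inc-map⁺ mono h (skip i) = skip (inc-map⁺ mono h i)

inc-map⁻ : ∀ {k l l′ w} {f : ℕ → ℕ} → (∀ {x y} → f x < f y → x < y) →
  (∀ {y} → l′ ≤ f y → l ≤ y) → Inc k l′ (map f w) → Inc k l w
inc-map⁻ {zero} cancel h _ = nil
inc-map⁻ {suc k} {w = x ∷ w} cancel h (pick l≤x i) = pick (h l≤x) (inc-map⁻ cancel cancel i)
inc-map⁻ {suc k} {w = x ∷ w} cancel h (skip i) = skip (inc-map⁻ cancel h i)

inc-++⁺ : ∀ {i j l m} {u s : List ℕ} → (∀ {v} → v ∈ u → v < m) → l ≤ m →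
  Inc i l u → Inc j m s → Inc (i + j) l (u ++ s)
inc-++⁺ {u = []} h l≤m nil b = inc-weaken l≤m b
inc-++⁺ {u = x ∷ u} h l≤m nil b = skip (inc-++⁺ (h ∘ there) l≤m nil b)
inc-++⁺ {u = x ∷ u} h l≤m (pick l≤x a) b = pick l≤x (inc-++⁺ (h ∘ there) (h (here refl)) a b)
inc-++⁺ {u = x ∷ u} h l≤m (skip a) b = skip (inc-++⁺ (h ∘ there) l≤m a b)

-- The part falling into `s` keeps only its length: its lower bound is relaxed to 0, which is all
-- that the counting of lengths in a direct sum asks for.
inc-++⁻ : ∀ {k l} u {s : List ℕ} → Inc k l (u ++ s) →
  ∃ λ i → ∃ λ j → i + j ≡ k × Inc i l u × Inc j 0 s
inc-++⁻ [] b = 0 , _ , refl , nil , inc-weaken z≤n b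
inc-++⁻ (x ∷ u) nil = 0 , 0 , refl , nil , nil
inc-++⁻ (x ∷ u) (pick l≤x i) with inc-++⁻ u i
... | a , b , refl , ia , ib = suc a , b , refl , pick l≤x ia , ib
inc-++⁻ (x ∷ u) (skip i) with inc-++⁻ u i
... | a , b , eq , ia , ib = a , b , eq , skip ia , ib

∈-subseqs⁻ : ∀ k w {l s} → s ∈ subseqs k w → AllPairs _<_ s → All (l ≤_) s → Inc k l w
∈-subseqs⁻ zero w _ _ _ = nil
∈-subseqs⁻ (suc k) (x ∷ w) s∈ ap al with ∈-++⁻ (map (x ∷_) (subseqs k w)) s∈
... | inj₂ s∈′ = skip (∈-subseqs⁻ (suc k) w s∈′ ap al)
... | inj₁ s∈′ with ∈-map⁻ (x ∷_) s∈′
∈-subseqs⁻ (suc k) (x ∷ w) s∈ (x< ∷ ap) (l≤x ∷ al) | inj₁ s∈′ | s′ , s′∈ , refl =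
  pick l≤x (∈-subseqs⁻ k w s′∈ ap x<)

∈-subseqs⁺ : ∀ {k l w} → Inc k l w →
  ∃ λ s → s ∈ subseqs k w × AllPairs _<_ s × All (l ≤_) s × length s ≡ k
∈-subseqs⁺ nil = [] , here refl , [] , [] , refl
∈-subseqs⁺ {w = x ∷ w} (pick l≤x i) with ∈-subseqs⁺ i
... | s , s∈ , ap , al , len = x ∷ s , ∈-++⁺ˡ (∈-map⁺ (x ∷_) s∈) , al ∷ ap ,
  l≤x ∷ All.map (≤-trans l≤x ∘ <⇒≤) al , cong suc len
∈-subseqs⁺ {zero} (skip i) = [] , here refl , [] , [] , refl
∈-subseqs⁺ {suc k} {w = x ∷ w} (skip i) with ∈-subseqs⁺ i
... | s , s∈ , ap , al , len = s , ∈-++⁺ʳ (map (x ∷_) (subseqs k w)) s∈ , ap , al , len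

pairsOK⁻ : ∀ {a as b} bs → All (a <_) as → pairsOK a as b bs ≡ true → All (b <_) bs
pairsOK⁻ {as = []} [] _ _ = []
pairsOK⁻ {a} {as = a′ ∷ as} {b} (b′ ∷ bs) (a<a′ ∷ al) eq rewrite <ᵇ-true a<a′ =
  let (b<b′ , eq′) = ∧⁻ eq in
  <ᵇ⇒< b b′ (≡⇒T b<b′) ∷ pairsOK⁻ bs al (proj₂ (∧⁻ eq′))

pairsOK⁺ : ∀ {a as b bs} → length as ≡ length bs → All (a <_) as → All (b <_) bs →
  pairsOK a as b bs ≡ true
pairsOK⁺ {as = []} {bs = []} _ _ _ = refl
pairsOK⁺ {as = _ ∷ _} {bs = _ ∷ _} len (a<a′ ∷ al) (b<b′ ∷ bl)
  rewrite <ᵇ-true a<a′ | <ᵇ-true b<b′ | <ᵇ-false (<-asym a<a′) | <ᵇ-false (<-asym b<b′) =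
  pairsOK⁺ (suc-injective len) al bl

orderIso⁻ : ∀ {τ} s → AllPairs _<_ τ → orderIso τ s ≡ true → AllPairs _<_ s
orderIso⁻ {[]} [] _ _ = []
orderIso⁻ {a ∷ τ} (b ∷ s) (al ∷ ap) eq =
  pairsOK⁻ s al (proj₁ (∧⁻ eq)) ∷ orderIso⁻ s ap (proj₂ (∧⁻ {pairsOK a τ b s} eq))

orderIso⁺ : ∀ {τ s} → length τ ≡ length s → AllPairs _<_ τ → AllPairs _<_ s → orderIso τ s ≡ true
orderIso⁺ {[]} {[]} _ _ _ = refl
orderIso⁺ {a ∷ τ} {b ∷ s} len (al ∷ ap) (bl ∷ bp) =
  ∧⁺ (pairsOK⁺ (suc-injective len) al bl) (orderIso⁺ (suc-injective len) ap bp)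

-- For an increasing pattern, order-isomorphic means increasing of the same length, so containment
-- becomes `Inc`.
module _ {τ : List ℕ} (inc : AllPairs _<_ τ) where

  contains⁻ : ∀ w → contains w τ ≡ true → Inc (length τ) 0 w
  contains⁻ w eq with anyL⁻ (subseqs (length τ) w) eq
  ... | s , s∈ , iso = ∈-subseqs⁻ (length τ) w s∈ (orderIso⁻ s inc iso) (All.tabulate (λ _ → z≤n))

  contains⁺ : ∀ w → Inc (length τ) 0 w → contains w τ ≡ true
  contains⁺ w i with ∈-subseqs⁺ i
  ... | s , s∈ , ap , _ , len = anyL⁺ s∈ (orderIso⁺ (sym len) inc ap)

  avoids⁻ : ∀ w → avoids w τ ≡ true → ¬ Inc (length τ) 0 w
  avoids⁻ w eq i rewrite contains⁺ w i with () ← eq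

  avoids⁺ : ∀ w → ¬ Inc (length τ) 0 w → avoids w τ ≡ true
  avoids⁺ w ni = cong not (≢true⇒≡false (ni ∘ contains⁻ w))

-- Words avoiding 123 and Catalan's triangle

perm-top : ∀ {n} → suc n ∷ range1 n ↭ range1 (suc n)
perm-top {n} = subst (suc n ∷ range1 n ↭_) (sym (range1-∷ʳ n)) (∷↭∷ʳ (suc n) (range1 n))

perm-top⁺ : ∀ {n u} → Perm n u → Perm (suc n) (suc n ∷ u)
perm-top⁺ p = ↭-trans (prep _ p) perm-top

perm-top⁻ : ∀ {n u} → Perm (suc n) (suc n ∷ u) → Perm n u
perm-top⁻ p = drop-∷ (↭-trans p (↭-sym perm-top))

perm-0 : ∀ {w} → Perm 0 w → w ≡ []
perm-0 = ↭-empty-inv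

inc? : ∀ k l w → Dec (Inc k l w)
inc? zero l w = yes nil
inc? (suc k) l [] = no λ ()
inc? (suc k) l (x ∷ w) with inc? (suc k) l w | l ≤? x | inc? k (suc x) w
... | yes i | _       | _     = yes (skip i)
... | no _  | yes l≤x | yes i = yes (pick l≤x i)
... | no ¬s | no l≰x  | _     = no λ { (pick l≤x _) → l≰x l≤x ; (skip i) → ¬s i }
... | no ¬s | yes _   | no ¬i = no λ { (pick _ i) → ¬i i ; (skip i) → ¬s i }

-- The second entry of the subsequence lies strictly above the bound. This excludes pairs whose
-- lower entry would have to be the largest value.
inc-2⁻ : ∀ {k l w} → Inc (suc (suc k)) l w → ∃ λ v → v ∈ w × l < v
inc-2⁻ (pick l≤x i) with inc-1⁻ i
... | v , v∈ , x<v = v , there v∈ , ≤-trans (s≤s l≤x) x<v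
inc-2⁻ (skip i) with inc-2⁻ i
... | v , v∈ , l<v = v , there v∈ , l<v

inc-∷-max : ∀ {k l n u} → (∀ {v} → v ∈ u → v ≤ n) → Inc (suc (suc k)) l (n ∷ u) → Inc (suc (suc k)) l u
inc-∷-max h (pick _ i) with inc-1⁻ i
... | v , v∈ , n<v = ⊥-elim (<⇒≱ n<v (h v∈))
inc-∷-max h (skip i) = i

-- The decreasing permutation n, n - 1, ..., 1.
δ : ℕ → List ℕ
δ zero = []
δ (suc n) = suc n ∷ δ n

δ-perm : ∀ n → Perm n (δ n)
δ-perm zero = ↭-refl
δ-perm (suc n) = perm-top⁺ (δ-perm n)

δ-noninc : ∀ n {l} → ¬ Inc 2 l (δ n)
δ-noninc (suc n) i = δ-noninc n (inc-∷-max (λ v∈ → m≤n⇒m≤1+n (proj₂ (perm-bounds (δ-perm n) v∈))) i)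

-- If the maximum is not the first letter, then the first letter together with the maximum is an
-- increasing pair. The bound 1 fits `B n 0` directly.
noninc⇒δ : ∀ n {w} → Perm n w → ¬ Inc 2 1 w → w ≡ δ n
noninc⇒δ zero p _ = perm-0 p
noninc⇒δ (suc n) {[]} p _ with () ← perm-length p
noninc⇒δ (suc n) {x ∷ u} p ni with perm-∈ p (s≤s z≤n) (≤-refl {suc n})
... | here refl = cong (suc n ∷_) (noninc⇒δ n (perm-top⁻ p) (ni ∘ skip))
... | there n∈ with m≤n⇒m<n∨m≡n (proj₂ (perm-bounds p (here refl)))
...   | inj₁ x<n = ⊥-elim (ni (pick (proj₁ (perm-bounds p (here refl))) (inc-1⁺ n∈ x<n)))
...   | inj₂ refl = cong (suc n ∷_) (noninc⇒δ n (perm-top⁻ p) (ni ∘ skip))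

module _ {f : ℕ → ℕ} (mono : ∀ {x y} → x < y → f x < f y) where

  mono-cancel : ∀ {x y} → f x < f y → x < y
  mono-cancel {x} {y} fx<fy with <-cmp x y
  ... | tri< x<y _ _ = x<y
  ... | tri≈ _ refl _ = ⊥-elim (<-irrefl refl fx<fy)
  ... | tri> _ _ y<x = ⊥-elim (<-asym fx<fy (mono y<x))

  mono-injective : ∀ {x y} → f x ≡ f y → x ≡ y
  mono-injective {x} {y} eq with <-cmp x y
  ... | tri< x<y _ _ = ⊥-elim (<-irrefl eq (mono x<y))
  ... | tri≈ _ x≡y _ = x≡y
  ... | tri> _ _ y<x = ⊥-elim (<-irrefl (sym eq) (mono y<x))

-- The order-preserving relabelling that makes room for a new letter of value j: its image is
-- everything except j.
bump : ℕ → ℕ → ℕ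
bump j x = if x <ᵇ j then x else suc x

bump-< : ∀ {j x} → x < j → bump j x ≡ x
bump-< x<j rewrite <ᵇ-true x<j = refl

bump-≥ : ∀ {j x} → j ≤ x → bump j x ≡ suc x
bump-≥ j≤x rewrite <ᵇ-false (≤⇒≯ j≤x) = refl

bump-mono : ∀ j {x y} → x < y → bump j x < bump j y
bump-mono j {x} {y} x<y with x <? j | y <? j
... | yes x<j | yes y<j rewrite bump-< x<j | bump-< y<j = x<y
... | yes x<j | no y≮j rewrite bump-< x<j | bump-≥ (≮⇒≥ y≮j) = m<n⇒m<1+n x<y
... | no x≮j | yes y<j = ⊥-elim (x≮j (<-trans x<y y<j))
... | no x≮j | no y≮j rewrite bump-≥ (≮⇒≥ x≮j) | bump-≥ (≮⇒≥ y≮j) = s<s x<y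

bump-injective : ∀ j {x y} → bump j x ≡ bump j y → x ≡ y
bump-injective j = mono-injective (bump-mono j)

bump-≢ : ∀ j x → bump j x ≢ j
bump-≢ j x with x <? j
... | yes x<j rewrite bump-< x<j = <⇒≢ x<j
... | no x≮j rewrite bump-≥ (≮⇒≥ x≮j) = λ eq → <⇒≢ (s≤s (≮⇒≥ x≮j)) (sym eq)

bump-bounds : ∀ j x → x ≤ bump j x × bump j x ≤ suc x
bump-bounds j x with x <? j
... | yes x<j rewrite bump-< x<j = ≤-refl , n≤1+n x
... | no x≮j rewrite bump-≥ (≮⇒≥ x≮j) = n≤1+n x , ≤-refl

bump-raise : ∀ {j y} → j ≤ y → suc j ≤ bump j y
bump-raise j≤y rewrite bump-≥ j≤y = s≤s j≤y

bump-lower : ∀ {j y} → suc j ≤ bump j y → j ≤ y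
bump-lower {j} {y} h = s≤s⁻¹ (≤-trans h (proj₂ (bump-bounds j y)))

perm-bump⁺ : ∀ {n j u} → 1 ≤ j → j ≤ suc n → Perm n u → Perm (suc n) (j ∷ map (bump j) u)
perm-bump⁺ {n} {j} {u} 1≤j j≤ p = perm-intro
  (All.tabulate (λ v∈ eq → let (x , _ , e) = ∈-map⁻ (bump j) v∈ in bump-≢ j x (sym (trans eq e)))
    ∷ Unique.map⁺ (bump-injective j) (perm-unique p))
  (cong suc (trans (length-map (bump j) u) (perm-length p)))
  bounds
  where
  bounds : ∀ {v} → v ∈ j ∷ map (bump j) u → 1 ≤ v × v ≤ suc n
  bounds (here refl) = 1≤j , j≤
  bounds (there v∈) with ∈-map⁻ (bump j) v∈
  ... | x , x∈ , refl = ≤-trans (proj₁ (perm-bounds p x∈)) (proj₁ (bump-bounds j x)) ,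
                        ≤-trans (proj₂ (bump-bounds j x)) (s≤s (proj₂ (perm-bounds p x∈)))

-- Inserting j in front of the relabelled identity also gives a permutation of the same size.
-- Cancelling j shows that `u` rearranges the relabelled identity, and a rearrangement of an image
-- is the image of a rearrangement.
perm-bump⁻ : ∀ {n j u} → Perm (suc n) (j ∷ u) → ∃ λ u′ → u ≡ map (bump j) u′ × Perm n u′
perm-bump⁻ p with ↭-map-inv _ (drop-∷ (↭-trans
  (perm-bump⁺ (proj₁ (perm-bounds p (here refl))) (proj₂ (perm-bounds p (here refl))) ↭-refl) (↭-sym p)))
... | u′ , eq , q = u′ , eq , ↭-sym q

-- In B n k every pair u < v occurring in this order has u ≤ k; in D n k the largest such u is k + 1.
B D : ℕ → ℕ → List ℕ → Set
B n k w = Perm n w × ¬ Inc 3 0 w × ¬ Inc 2 (suc k) w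
D n k w = Perm n w × ¬ Inc 3 0 w × ¬ Inc 2 (suc (suc k)) w × Inc 2 (suc k) w

-- For k < n the two definitions combine to b(n+1,k+1) = b(n+1,k) + b(n,k+1), the rule of Catalan's
-- triangle. The test `k <ᵇ n` reflects that a lower entry k + 1 in a word of size n + 1 needs a
-- larger value.
b d : ℕ → ℕ → ℕ
b n zero = 1
b n (suc k) = b n k + d n k
d zero k = 0
d (suc n) k = if k <ᵇ n then b n k + d n k else 0

-- Prepending the maximum creates no increasing pair. When k + 1 is prepended, the later letters
-- above it come from letters of `u` that are at least k + 1, so the one condition on pairs in
-- `B n k` rules out both a 123 starting at the new letter and a pair lying above it.
D-step : ∀ {n k} → k < n → ∀ {w} →
  (∃ λ u → B n k u × w ≡ suc k ∷ map (bump (suc k)) u) ⊎ (∃ λ u → D n k u × w ≡ suc n ∷ u) →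
  D (suc n) k w
D-step {n} {k} k<n (inj₁ (u , (p , n3 , n2) , refl)) =
  perm-bump⁺ (s≤s z≤n) (m≤n⇒m≤1+n k<n) p , no3 , no2 , has2
  where
  cancel = mono-cancel (bump-mono (suc k))
  no3 : ¬ Inc 3 0 (suc k ∷ map (bump (suc k)) u)
  no3 (pick _ i) = n2 (inc-map⁻ cancel bump-lower i)
  no3 (skip i) = n3 (inc-map⁻ cancel (λ _ → z≤n) i)
  no2 : ¬ Inc 2 (suc (suc k)) (suc k ∷ map (bump (suc k)) u)
  no2 (pick l≤ _) = <-irrefl refl l≤
  no2 (skip i) = n2 (inc-map⁻ cancel bump-lower i)
  -- The letter n of `u` becomes n + 1, and k + 1 forms the required pair with it.
  has2 : Inc 2 (suc k) (suc k ∷ map (bump (suc k)) u)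
  has2 = pick ≤-refl (inc-1⁺ (∈-map⁺ (bump (suc k)) (perm-∈ p (≤-trans (s≤s z≤n) k<n) ≤-refl))
                            (bump-raise k<n))
D-step {n} {k} k<n (inj₂ (u , (p , n3 , n2 , y2) , refl)) =
  perm-top⁺ p , n3 ∘ inc-∷-max le , n2 ∘ inc-∷-max le , skip y2
  where
  le : ∀ {v} → v ∈ u → v ≤ suc n
  le v∈ = m≤n⇒m≤1+n (proj₂ (perm-bounds p v∈))

D-step⁻ : ∀ {n k w} → D (suc n) k w →
  (∃ λ u → B n k u × w ≡ suc k ∷ map (bump (suc k)) u) ⊎ (∃ λ u → D n k u × w ≡ suc n ∷ u)
D-step⁻ {w = []} (p , _) with () ← perm-length p
D-step⁻ {n} {k} {x ∷ u} (p , n3 , n2 , y2) with m≤n⇒m<n∨m≡n (proj₂ (perm-bounds p (here refl)))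
... | inj₂ refl = inj₂ (u , (perm-top⁻ p , n3 ∘ skip , n2 ∘ skip ,
  inc-∷-max (λ v∈ → proj₂ (perm-bounds p (there v∈))) y2) , refl)
... | inj₁ x<top = inj₁ (go (≤-antisym x≤ x≥) p)
  where
  top∈ : suc n ∈ u
  top∈ with perm-∈ p (s≤s z≤n) (≤-refl {suc n})
  ... | here refl = ⊥-elim (<-irrefl refl x<top)
  ... | there t = t
  -- A larger first letter would form a forbidden pair with n + 1, which comes later.
  x≤ : x ≤ suc k
  x≤ = ≮⇒≥ λ k<x → n2 (pick k<x (inc-1⁺ top∈ x<top))
  tail2 : x < suc k → Inc 2 (suc k) (x ∷ u) → Inc 2 (suc k) u
  tail2 x<k (pick k≤x _) = ⊥-elim (<⇒≱ x<k k≤x)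
  tail2 _ (skip i) = i
  -- A smaller first letter would extend the pair guaranteed by `y2`, which then lies in the tail,
  -- to a 123.
  x≥ : suc k ≤ x
  x≥ = ≮⇒≥ λ x<k → n3 (pick z≤n (inc-weaken x<k (tail2 x<k y2)))
  go : x ≡ suc k → Perm (suc n) (x ∷ u) → _
  go refl q with perm-bump⁻ q
  ... | u′ , refl , p′ = u′ , (p′ ,
    (λ i → n3 (skip (inc-map⁺ (bump-mono (suc k)) (λ _ → z≤n) i))) ,
    (λ i → n2 (skip (inc-map⁺ (bump-mono (suc k)) bump-raise i)))) , refl

card-B : ∀ n k → Card (B n k) (b n k)
card-D : ∀ n k → Card (D n k) (d n k)
card-B n zero = card-singleton (δ n)
  (δ-perm n , δ-noninc n ∘ inc-2 , δ-noninc n)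
  (λ (p , _ , ni) → noninc⇒δ n p ni)
  where
  inc-2 : ∀ {w} → Inc 3 0 w → Inc 2 0 w
  inc-2 = inc-shorten
card-B n (suc k) = card-cong
  (λ { (inj₁ (p , n3 , n2)) → p , n3 , n2 ∘ inc-weaken (n≤1+n _)
     ; (inj₂ (p , n3 , n2 , _)) → p , n3 , n2 })
  split
  (card-⊎ (λ { (_ , _ , n2) (_ , _ , _ , y2) → n2 y2 }) (card-B n k) (card-D n k))
  where
  split : ∀ {w} → B n (suc k) w → B n k w ⊎ D n k w
  split {w} (p , n3 , n2) with inc? 2 (suc k) w
  ... | yes i = inj₂ (p , n3 , n2 , i)
  ... | no ni = inj₁ (p , n3 , ni)
card-D zero k = card-empty (λ { (p , _ , _ , i) → empty (perm-0 p) i })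
  where
  empty : ∀ {l w} → w ≡ [] → ¬ Inc 2 l w
  empty refl ()
card-D (suc n) k with k <ᵇ n in eq
... | true = card-cong (D-step k<n) D-step⁻
  (card-⊎ (λ { (_ , _ , e) (_ , _ , e′) → <⇒≢ (s<s k<n) (proj₁ (∷-injective (trans (sym e) e′))) })
    (card-image (λ u → suc k ∷ map (bump (suc k)) u)
      (map-injective (bump-injective (suc k)) ∘ ∷-injectiveʳ) (card-B n k))
    (card-image (suc n ∷_) ∷-injectiveʳ (card-D n k)))
  where
  k<n : k < n
  k<n = <ᵇ⇒< k n (≡⇒T eq)
... | false = card-empty λ (p , _ , _ , y2) → let (v , v∈ , k<v) = inc-2⁻ y2 in
  case-≥ (≤-trans k<v (proj₂ (perm-bounds p v∈)))
  where
  case-≥ : ¬ (suc k < suc n)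
  case-≥ (s≤s k<n) with () ← trans (sym (<ᵇ-true k<n)) eq

-- At k = n the condition on pairs is automatic: no pair can have its lower entry above n.
card-123 : ∀ n → Card (λ w → Perm n w × ¬ Inc 3 0 w) (b n n)
card-123 n = card-cong (λ (p , n3 , _) → p , n3)
  (λ (p , n3) → p , n3 , λ i → let (v , v∈ , n<v) = inc-2⁻ i in
    <⇒≱ (<⇒≤ n<v) (proj₂ (perm-bounds p v∈)))
  (card-B n n)

-- the binomial coefficient n over k - 1, with value 0 at k = 0
C⁻ : ℕ → ℕ → ℕ
C⁻ n zero = 0
C⁻ n (suc k) = n C k

C⁻-pascal : ∀ n k → C⁻ n k + n C k ≡ suc n C k
C⁻-pascal n zero = refl
C⁻-pascal n (suc k) = nCk+nC[k+1]≡[n+1]C[k+1] n k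

-- The identity (k+1) C(n,k+1) = (n-k) C(n,k), with the subtracted term moved to the left; Pascal's
-- rule reduces it to two smaller instances.
C-absorb : ∀ n k → suc k * (n C suc k) + k * (n C k) ≡ n * (n C k)
C-absorb zero zero = refl
C-absorb zero (suc k) = cong₂ _+_ (*-zeroʳ (suc (suc k))) (*-zeroʳ (suc k))
C-absorb (suc n) zero rewrite nC1≡n (suc n) = lem n
  where
  lem : ∀ n → 1 * suc n + 0 ≡ suc n * 1
  lem = solve-∀
C-absorb (suc n) (suc k) rewrite sym (nCk+nC[k+1]≡[n+1]C[k+1] n k) | sym (nCk+nC[k+1]≡[n+1]C[k+1] n (suc k)) =
  begin
    suc (suc k) * (x + y) + suc k * (z + x)
      ≡⟨ l₁ k x y z ⟩
    (suc (suc k) * y + suc k * x) + (suc k * x + k * z) + (x + z)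
      ≡⟨ cong₂ (λ s t → s + t + (x + z)) (C-absorb n (suc k)) (C-absorb n k) ⟩
    n * x + n * z + (x + z)
      ≡⟨ l₂ n x z ⟩
    suc n * (z + x) ∎
  where
  open ≡-Reasoning
  x = n C suc k
  y = n C suc (suc k)
  z = n C k
  l₁ : ∀ k x y z → suc (suc k) * (x + y) + suc k * (z + x) ≡
       (suc (suc k) * y + suc k * x) + (suc k * x + k * z) + (x + z)
  l₁ = solve-∀
  l₂ : ∀ n x z → n * x + n * z + (x + z) ≡ suc n * (z + x)
  l₂ = solve-∀

-- The ballot formula b(n,k) = C(n+k,k) - C(n+k,k-1) in additive form. Off the diagonal both sides
-- obey Pascal's rule. On the diagonal the recurrence loses a term, and the symmetry of the middle
-- binomials makes up for it.
b-closed : ∀ n k → k ≤ n → b n k + C⁻ (n + k) k ≡ (n + k) C k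
b-closed n zero _ = refl
b-closed (suc n) (suc k) (s≤s k≤n) with m≤n⇒m<n∨m≡n k≤n
... | inj₁ k<n rewrite <ᵇ-true k<n | +-suc n k = begin
    b (suc n) k + b n (suc k) + suc N C k
      ≡⟨ cong (b (suc n) k + b n (suc k) +_) (C⁻-pascal N k) ⟨
    b (suc n) k + b n (suc k) + (C⁻ N k + N C k)
      ≡⟨ l (b (suc n) k) (b n (suc k)) (C⁻ N k) (N C k) ⟩
    (b (suc n) k + C⁻ N k) + (b n (suc k) + N C k)
      ≡⟨ cong₂ _+_ (b-closed (suc n) k (m≤n⇒m≤1+n k≤n))
          (subst (λ M → b n (suc k) + M C k ≡ M C suc k) (+-suc n k) (b-closed n (suc k) k<n)) ⟩
    N C k + N C suc k
      ≡⟨ nCk+nC[k+1]≡[n+1]C[k+1] N k ⟩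
    suc N C suc k ∎
  where
  open ≡-Reasoning
  N = suc (n + k)
  l : ∀ p q r s → p + q + (r + s) ≡ (p + r) + (q + s)
  l = solve-∀
... | inj₂ refl rewrite <ᵇ-false (<-irrefl {k} refl) | +-suc k k = begin
    b (suc k) k + 0 + suc N C k
      ≡⟨ cong₂ _+_ (+-identityʳ (b (suc k) k)) (sym (C⁻-pascal N k)) ⟩
    b (suc k) k + (C⁻ N k + N C k)
      ≡⟨ +-assoc (b (suc k) k) _ _ ⟨
    (b (suc k) k + C⁻ N k) + N C k
      ≡⟨ cong₂ _+_ (b-closed (suc k) k (n≤1+n k)) middle ⟩
    N C k + N C suc k
      ≡⟨ nCk+nC[k+1]≡[n+1]C[k+1] N k ⟩
    suc N C suc k ∎
  where
  open ≡-Reasoning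
  N = suc (k + k)
  middle : N C k ≡ N C suc k
  middle = trans (nCk≡nC[n∸k] {k} {N} (m≤n⇒m≤1+n (m≤m+n k k)))
    (cong (N C_) (trans (+-∸-assoc 1 (m≤m+n k k)) (cong suc (m+n∸m≡n k k))))

suc-*-C⁻ : ∀ n → suc n * C⁻ (n + n) n ≡ n * ((n + n) C n)
suc-*-C⁻ zero = refl
suc-*-C⁻ (suc m) = +-cancelʳ-≡ (m * (N C m)) _ _ (begin
    suc (suc m) * (N C m) + m * (N C m) ≡⟨ l m (N C m) ⟩
    N * (N C m)                         ≡⟨ C-absorb N m ⟨
    suc m * (N C suc m) + m * (N C m)   ∎)
  where
  open ≡-Reasoning
  N = suc m + suc m
  l : ∀ m x → suc (suc m) * x + m * x ≡ (suc m + suc m) * x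
  l = solve-∀

-- Multiplying the ballot formula by n + 1 turns its subtracted term into n C(2n,n) by `suc-*-C⁻`,
-- which leaves (n+1) b(n,n) = C(2n,n); the division defining `catalan` is therefore exact.
b-catalan : ∀ n → b n n ≡ catalan n
b-catalan n = sym (begin
    ((2 * n) C n) / suc n ≡⟨ cong (λ N → (N C n) / suc n) (cong (n +_) (+-identityʳ n)) ⟩
    ((n + n) C n) / suc n ≡⟨ cong (_/ suc n) mult ⟨
    (b n n * suc n) / suc n ≡⟨ m*n/n≡m (b n n) (suc n) ⟩
    b n n ∎)
  where
  open ≡-Reasoning
  mult : b n n * suc n ≡ (n + n) C n
  mult = +-cancelʳ-≡ (n * ((n + n) C n)) _ _ (begin
    b n n * suc n + n * ((n + n) C n)         ≡⟨ cong₂ _+_ (*-comm (b n n) (suc n)) (sym (suc-*-C⁻ n)) ⟩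
    suc n * b n n + suc n * C⁻ (n + n) n      ≡⟨ *-distribˡ-+ (suc n) (b n n) _ ⟨
    suc n * (b n n + C⁻ (n + n) n)            ≡⟨ cong (suc n *_) (b-closed n n ≤-refl) ⟩
    suc n * ((n + n) C n)                     ∎)

-- Direct sums and indecomposable blocks

take-++-≤ : ∀ {A : Set} k (u s : List A) → k ≤ length u → take k (u ++ s) ≡ take k u
take-++-≤ zero u s _ = refl
take-++-≤ (suc k) (x ∷ u) s (s≤s h) = cong (x ∷_) (take-++-≤ k u s h)

take-length : ∀ {A : Set} (u s : List A) → take (length u) (u ++ s) ≡ u
take-length [] s = refl
take-length (x ∷ u) s = cong (x ∷_) (take-length u s)

++-cancelˡ-↭ : ∀ {A : Set} (u : List A) {s t} → u ++ s ↭ u ++ t → s ↭ t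
++-cancelˡ-↭ [] p = p
++-cancelˡ-↭ (x ∷ u) p = ++-cancelˡ-↭ u (drop-∷ p)

range1-+ : ∀ a c → range1 (a + c) ≡ range1 a ++ map (a +_) (range1 c)
range1-+ a zero = trans (cong range1 (+-identityʳ a)) (sym (++-identityʳ (range1 a)))
range1-+ a (suc c) = begin
    range1 (a + suc c)                              ≡⟨ cong range1 (+-suc a c) ⟩
    range1 (suc (a + c))                            ≡⟨ range1-∷ʳ (a + c) ⟩
    range1 (a + c) ++ suc (a + c) ∷ []              ≡⟨ cong₂ (λ u x → u ++ x ∷ []) (range1-+ a c) (sym (+-suc a c)) ⟩
    (range1 a ++ map (a +_) (range1 c)) ++ (a + suc c) ∷ [] ≡⟨ ++-assoc (range1 a) _ _ ⟩
    range1 a ++ map (a +_) (range1 c) ++ (a + suc c) ∷ []   ≡⟨ cong (range1 a ++_) (map-++ (a +_) (range1 c) (suc c ∷ [])) ⟨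
    range1 a ++ map (a +_) (range1 c ∷ʳ suc c)      ≡⟨ cong (λ u → range1 a ++ map (a +_) u) (range1-∷ʳ c) ⟨
    range1 a ++ map (a +_) (range1 (suc c))         ∎
  where open ≡-Reasoning

perm-⊕⁺ : ∀ {a c α β} → Perm a α → Perm c β → Perm (a + c) (α ++ map (a +_) β)
perm-⊕⁺ {a} {c} p q = subst (_ ↭_) (sym (range1-+ a c)) (++⁺ p (map⁺ (a +_) q))

perm-⊕⁻ : ∀ {a c α s} → Perm (a + c) (α ++ s) → Perm a α → ∃ λ β → s ≡ map (a +_) β × Perm c β
perm-⊕⁻ {a} {c} {α} p q with ↭-map-inv (a +_) (↭-sym (++-cancelˡ-↭ α
  (↭-trans (subst (_ ↭_) (range1-+ a c) p) (++⁺ (↭-sym q) ↭-refl))))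
... | β , eq , r = β , eq , ↭-sym r

<ᵇ-+ : ∀ a x y → (a + x <ᵇ a + y) ≡ (x <ᵇ y)
<ᵇ-+ zero x y = refl
<ᵇ-+ (suc a) x y = <ᵇ-+ a x y

des-map : ∀ a w → des (map (a +_) w) ≡ des w
des-map a [] = refl
des-map a (x ∷ []) = refl
des-map a (x ∷ y ∷ w) = cong₂ (λ e m → (if e then 1 else 0) + m) (<ᵇ-+ a y x) (des-map a (y ∷ w))

-- The bound `a` separates the two words, so their junction is an ascent.
des-++ : ∀ {a} u s → (∀ {v} → v ∈ u → v ≤ a) → (∀ {v} → v ∈ s → a < v) → des (u ++ s) ≡ des u + des s
des-++ [] s _ _ = refl
des-++ (x ∷ []) [] _ _ = refl
des-++ (x ∷ []) (y ∷ s) h k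
  rewrite <ᵇ-false (<-asym (≤-<-trans (h (here refl)) (k (here refl)))) = refl
des-++ (x ∷ y ∷ u) s h k = trans (cong (e +_) (des-++ (y ∷ u) s (h ∘ there) k)) (sym (+-assoc e _ _))
  where e = if y <ᵇ x then 1 else 0

des-δ : ∀ n → des (δ (suc n)) ≡ n
des-δ zero = refl
des-δ (suc n) rewrite <ᵇ-true (n<1+n n) = cong suc (des-δ n)

module _ {a c : ℕ} {α β : List ℕ} (p : Perm a α) (q : Perm c β) where

  shifted-> : ∀ {v} → v ∈ map (a +_) β → a < v
  shifted-> v∈ with ∈-map⁻ (a +_) v∈
  ... | x , x∈ , refl = m<m+n a (proj₁ (perm-bounds q x∈))

  des-⊕ : des (α ++ map (a +_) β) ≡ des α + des β
  des-⊕ = trans (des-++ α _ (proj₂ ∘ perm-bounds p) shifted->) (cong (des α +_) (des-map a β))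

  inc-⊕⁺ : ∀ {i j} → Inc i 0 α → Inc j 0 β → Inc (i + j) 0 (α ++ map (a +_) β)
  inc-⊕⁺ i j = inc-++⁺ (s≤s ∘ proj₂ ∘ perm-bounds p) z≤n i
    (inc-raise shifted-> (inc-map⁺ (+-monoʳ-< a) (λ _ → z≤n) j))

  -- A subsequence of length i + j + 1 splits between the summands, so either more than i of its
  -- entries lie in `α` or more than j lie in `β`.
  noninc-⊕ : ∀ {i j} → ¬ Inc (suc i) 0 α → ¬ Inc (suc j) 0 β → ¬ Inc (suc (i + j)) 0 (α ++ map (a +_) β)
  noninc-⊕ {i} {j} nα nβ inc with inc-++⁻ α inc
  ... | i′ , j′ , eq , iα , iβ with i′ ≤? i
  ...   | no i′≰i = nα (inc-≤ (≰⇒> i′≰i) iα)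
  ...   | yes i′≤i = nβ (inc-≤ j<j′ (inc-map⁻ (+-cancelˡ-< a _ _) (λ _ → z≤n) iβ))
    where
    j<j′ : j < j′
    j<j′ = +-cancelˡ-≤ i (suc j) j′ (≤-trans (≤-reflexive (trans (+-suc i j) (sym eq))) (+-monoˡ-≤ j′ i′≤i))

block⁻ : ∀ {w i} → i ≤ length w → isBlock w i ≡ true → Perm i (take i w)
block⁻ {w} {i} i≤ eq = ↭-sym (pigeonhole (range1-unique i)
  (λ v∈ → memb⁻ _ (allL⁻ (proj₁ (∧⁻ eq)) v∈))
  (≤-reflexive (trans (length-take i w) (trans (m≤n⇒m⊓n≡m i≤) (sym (range1-length i))))))

block⁺ : ∀ {w i} → Perm i (take i w) → isBlock w i ≡ true
block⁺ p = ∧⁺ (allL⁺ (λ v∈ → memb⁺ (∈-resp-↭ (↭-sym p) v∈))) (allL⁺ (λ v∈ → memb⁺ (∈-resp-↭ p v∈)))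

-- Only proper nonempty prefixes are tested. The empty word satisfies this vacuously, unlike
-- `indec`, which is why `indec⁺` speaks of size `suc n`.
Indec : List ℕ → Set
Indec w = ∀ {i} → 1 ≤ i → i < length w → isBlock w i ≡ false

firstTrue-∷ʳ⁺ : ∀ {p z} xs → (∀ {x} → x ∈ xs → p x ≡ false) → p z ≡ true → firstTrue p (xs ∷ʳ z) ≡ z
firstTrue-∷ʳ⁺ [] _ pz rewrite pz = refl
firstTrue-∷ʳ⁺ (x ∷ xs) h pz rewrite h (here refl) = firstTrue-∷ʳ⁺ xs (h ∘ there) pz

firstTrue-∷ʳ⁻ : ∀ {p z} xs → (∀ {x} → x ∈ xs → x ≢ z) → firstTrue p (xs ∷ʳ z) ≡ z →
  ∀ {x} → x ∈ xs → p x ≡ false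
firstTrue-∷ʳ⁻ {p} (x ∷ xs) h eq x∈ with p x in px
firstTrue-∷ʳ⁻ (x ∷ xs) h eq x∈ | true = ⊥-elim (h (here refl) eq)
firstTrue-∷ʳ⁻ (x ∷ xs) h eq (here refl) | false = px
firstTrue-∷ʳ⁻ (x ∷ xs) h eq (there x∈) | false = firstTrue-∷ʳ⁻ xs (h ∘ there) eq x∈

indec⁻ : ∀ w → indec w ≡ true → Indec w
indec⁻ (x ∷ w) eq 1≤i i< = firstTrue-∷ʳ⁻ (range1 (length w))
  (λ v∈ → <⇒≢ (s≤s (proj₂ (∈-range1⁻ v∈))))
  (trans (cong (firstTrue (isBlock (x ∷ w))) (sym (range1-∷ʳ (length w)))) (≡ᵇ⇒≡ _ _ (≡⇒T eq)))
  (∈-range1⁺ 1≤i (s≤s⁻¹ i<))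

indec⁺ : ∀ {n w} → Perm (suc n) w → Indec w → indec w ≡ true
indec⁺ {w = []} p _ with () ← perm-length p
indec⁺ {n} {x ∷ w} p ind = T⇒≡ (≡⇒≡ᵇ (firstTrue (isBlock (x ∷ w)) (range1 (suc (length w)))) (suc (length w))
  (trans (cong (firstTrue (isBlock (x ∷ w))) (range1-∷ʳ (length w)))
    (firstTrue-∷ʳ⁺ (range1 (length w))
      (λ v∈ → ind (proj₁ (∈-range1⁻ v∈)) (s≤s (proj₂ (∈-range1⁻ v∈))))
      (block⁺ {x ∷ w} (subst (Perm (suc (length w))) (cong (x ∷_) (sym (take-all w)))
        (subst (λ m → Perm m (x ∷ w)) (sym (perm-length p)) p))))))
  where
  take-all : ∀ (u : List ℕ) → take (length u) u ≡ u
  take-all u = trans (cong (take (length u)) (sym (++-identityʳ u))) (take-length u [])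

least : (p : ℕ → Bool) → ∀ m → (∀ {i} → 1 ≤ i → i < m → p i ≡ false) ⊎
  (∃ λ a → 1 ≤ a × a < m × p a ≡ true × (∀ {i} → 1 ≤ i → i < a → p i ≡ false))
least p zero = inj₁ λ _ ()
least p (suc zero) = inj₁ λ { (s≤s _) (s≤s ()) }
least p (suc (suc m)) with least p (suc m)
... | inj₂ (a , 1≤a , a<m , pa , h) = inj₂ (a , 1≤a , m<n⇒m<1+n a<m , pa , h)
... | inj₁ h with p (suc m) in eq
...   | true = inj₂ (suc m , s≤s z≤n , ≤-refl , eq , h)
...   | false = inj₁ h′
  where
  h′ : ∀ {i} → 1 ≤ i → i < suc (suc m) → p i ≡ false
  h′ 1≤i (s≤s i≤m) with m≤n⇒m<n∨m≡n i≤m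
  ... | inj₁ i<m = h 1≤i i<m
  ... | inj₂ refl = eq

-- The test at i reads only the first i letters, so the blocks inside a first summand are blocks of
-- the whole word.
isBlock-++ : ∀ u s {i} → i ≤ length u → isBlock (u ++ s) i ≡ isBlock u i
isBlock-++ u s {i} i≤ = cong (λ t → allL (λ v → memb v t) (range1 i) ∧ allL (λ v → memb v (range1 i)) t)
  (take-++-≤ i u s i≤)

-- Both summands are nonempty because their sizes are successors. Only `α` is indecomposable, which
-- makes it the first block.
record Decomposition (n : ℕ) (w : List ℕ) : Set where
  constructor decomp
  field
    {a c}   : ℕ
    α β     : List ℕ
    sum     : suc a + suc c ≡ n
    α-perm  : Perm (suc a) α
    β-perm  : Perm (suc c) β
    α-indec : Indec α
    word    : w ≡ α ++ map (suc a +_) β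

decompose : ∀ {n w} → Perm n w → Indec w ⊎ Decomposition n w
decompose {n} {w} p with least (isBlock w) (length w)
... | inj₁ h = inj₁ h
... | inj₂ (suc a , _ , a< , pa , h) = inj₂ (go (perm-⊕⁻ (subst₂ Perm sum≡ (sym (take++drop≡id (suc a) w)) p) α-perm))
  where
  α-perm = block⁻ (<⇒≤ a<) pa
  -- The prefix takes a + 1 letters; one more is removed because the size of the rest is written as
  -- a successor.
  c = length w ∸ suc (suc a)
  sum≡′ : suc a + suc c ≡ n
  sum≡′ = trans (trans (+-suc (suc a) c) (m+[n∸m]≡n a<)) (perm-length p)
  sum≡ = sym sum≡′
  len : length (take (suc a) w) ≡ suc a
  len = perm-length α-perm
  α-indec : Indec (take (suc a) w)
  α-indec {i} 1≤i i< = trans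
    (trans (sym (isBlock-++ (take (suc a) w) (drop (suc a) w) (<⇒≤ i<)))
      (cong (λ u → isBlock u i) (take++drop≡id (suc a) w)))
    (h 1≤i (subst (_ <_) len i<))
  go : (∃ λ β → drop (suc a) w ≡ map (suc a +_) β × Perm (suc c) β) → Decomposition n w
  go (β , eq , q) = decomp (take (suc a) w) β sum≡′ α-perm q α-indec
    (trans (sym (take++drop≡id (suc a) w)) (cong (take (suc a) w ++_) eq))

indec⇒no-prefix : ∀ {a u s x} → 1 ≤ a → Perm a u → ¬ Indec (u ++ x ∷ s)
indec⇒no-prefix {a} {u} {s} {x} 1≤a p ind = false≢true (trans (sym (ind 1≤a a<)) blk)
  where
  false≢true : false ≢ true
  false≢true ()
  a< : a < length (u ++ x ∷ s)
  a< = subst₂ _<_ (perm-length p) (sym (length-++ u)) (m<m+n (length u) z<s)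
  blk : isBlock (u ++ x ∷ s) a ≡ true
  blk = block⁺ {u ++ x ∷ s} (subst (Perm a)
    (sym (subst (λ n → take n (u ++ x ∷ s) ≡ u) (perm-length p) (take-length u (x ∷ s)))) p)

-- Two prefixes of one word are comparable, and a strictly shorter one would be a proper block of
-- the longer.
first-block-unique : ∀ {a a′ u u′ s s′} → 1 ≤ a → 1 ≤ a′ → Perm a u → Perm a′ u′ →
  Indec u → Indec u′ → u ++ s ≡ u′ ++ s′ → u ≡ u′
first-block-unique {s = s} {s′} 1≤a 1≤a′ p p′ ind ind′ eq = go (split _ _ eq) p p′ ind ind′
  where
  Comparable : (u u′ : List ℕ) → Set
  Comparable u u′ = u ≡ u′ ⊎ (∃₂ λ x t → u′ ≡ u ++ x ∷ t) ⊎ (∃₂ λ x t → u ≡ u′ ++ x ∷ t)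
  split : (u u′ : List ℕ) → u ++ s ≡ u′ ++ s′ → Comparable u u′
  split [] [] _ = inj₁ refl
  split [] (x ∷ t) _ = inj₂ (inj₁ (x , t , refl))
  split (x ∷ t) [] _ = inj₂ (inj₂ (x , t , refl))
  split (x ∷ u) (y ∷ u′) eq with ∷-injective eq
  ... | refl , eq′ with split u u′ eq′
  ...   | inj₁ refl = inj₁ refl
  ...   | inj₂ (inj₁ (z , t , refl)) = inj₂ (inj₁ (z , t , refl))
  ...   | inj₂ (inj₂ (z , t , refl)) = inj₂ (inj₂ (z , t , refl))
  go : ∀ {u u′} → Comparable u u′ → Perm _ u → Perm _ u′ → Indec u → Indec u′ → u ≡ u′
  go (inj₁ eq) _ _ _ _ = eq
  go (inj₂ (inj₁ (x , t , refl))) p _ _ ind′ = ⊥-elim (indec⇒no-prefix 1≤a p ind′)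
  go (inj₂ (inj₂ (x , t , refl))) _ p′ ind _ = ⊥-elim (indec⇒no-prefix 1≤a′ p′ ind)

-- A proper prefix starts with the maximum, which exceeds the length of that prefix.
δ-indec : ∀ n → Indec (δ n)
δ-indec zero _ ()
δ-indec (suc n) {suc i} _ i< = ≢true⇒≡false λ eq →
  <⇒≱ (subst (suc i <_) (perm-length (δ-perm (suc n))) i<)
      (proj₂ (perm-bounds (block⁻ {δ (suc n)} (<⇒≤ i<) eq) (here refl)))

-- Decomposable words avoiding 123 or 1234

p12 : List ℕ
p12 = 1 ∷ 2 ∷ []

p12-inc : AllPairs _<_ p12
p12-inc = ((s≤s (s≤s z≤n)) ∷ []) ∷ [] ∷ []

p123-inc : AllPairs _<_ p123
p123-inc = (s≤s (s≤s z≤n) ∷ s≤s (s≤s z≤n) ∷ []) ∷ (s≤s (s≤s (s≤s z≤n)) ∷ []) ∷ [] ∷ []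

p1234-inc : AllPairs _<_ p1234
p1234-inc = (s≤s (s≤s z≤n) ∷ s≤s (s≤s z≤n) ∷ s≤s (s≤s z≤n) ∷ [])
  ∷ (s≤s (s≤s (s≤s z≤n)) ∷ s≤s (s≤s (s≤s z≤n)) ∷ [])
  ∷ (s≤s (s≤s (s≤s (s≤s z≤n))) ∷ []) ∷ [] ∷ []

inc⇒1≤ : ∀ {n k l w} → Perm n w → Inc (suc k) l w → 1 ≤ n
inc⇒1≤ p i = let (v , v∈ , _) = inc-1⁻ i in
  ≤-trans (proj₁ (perm-bounds p v∈)) (proj₂ (perm-bounds p v∈))

perm⇒inc-1 : ∀ {n w} → Perm (suc n) w → Inc 1 0 w
perm⇒inc-1 p = inc-1⁺ (perm-∈ p ≤-refl (s≤s z≤n)) z≤n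

-- The test on the number of descents is a parameter: `_≡ᵇ i` extracts the coefficient of q^i, and a
-- constant test sets q = 1.
module _ (p : ℕ → Bool) where

  Avoiding Indecomposable : ℕ → ℕ → List ℕ → Set
  Avoiding k n w = Perm n w × ¬ Inc k 0 w × p (des w) ≡ true
  Indecomposable k n w = Avoiding k n w × indec w ≡ true

  -- Decreasing summands are indexed by their number of descents, so their sizes are suc a and suc b. The two
  -- predicates are disjoint because the first block of a DecreasingLast word contains 12.
  DecreasingFirst : ℕ → ℕ → ℕ → List ℕ → Set
  DecreasingFirst k n a w = ∃ λ β →
    (Perm (n ∸ suc a) β × ¬ Inc k 0 β × null β ≡ false × p (a + des β) ≡ true) ×
    w ≡ δ (suc a) ++ map (suc a +_) β

  DecreasingLast : ℕ → ℕ → List ℕ → Set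
  DecreasingLast n b w = ∃ λ α →
    (Perm (n ∸ suc b) α × ¬ Inc 3 0 α × indec α ≡ true × Inc 2 0 α × p (b + des α) ≡ true) ×
    w ≡ α ++ map (n ∸ suc b +_) (δ (suc b))

  decreasingFirst⇒avoiding : ∀ {k n a w} → a < n → DecreasingFirst (suc k) n a w → Avoiding (suc (suc k)) n w
  decreasingFirst⇒avoiding {k} {n} {a} a<n (β , (q , nβ , _ , pd) , refl) =
    subst (λ m → Perm m _) (m+[n∸m]≡n a<n) (perm-⊕⁺ (δ-perm (suc a)) q) ,
    noninc-⊕ (δ-perm (suc a)) q {1} (δ-noninc (suc a)) nβ ,
    trans (cong p (trans (des-⊕ (δ-perm (suc a)) q) (cong (_+ des β) (des-δ a)))) pd

  decreasingLast⇒avoiding : ∀ {n b w} → b < n → DecreasingLast n b w → Avoiding 4 n w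
  decreasingLast⇒avoiding {n} {b} b<n (α , (q , nα , _ , _ , pd) , refl) =
    subst (λ m → Perm m (α ++ map (n ∸ suc b +_) (δ (suc b)))) (m∸n+n≡m b<n) (perm-⊕⁺ q (δ-perm (suc b))) ,
    noninc-⊕ q (δ-perm (suc b)) {2} nα (δ-noninc (suc b)) ,
    trans (cong p (trans (des-⊕ q (δ-perm (suc b))) (trans (cong (des α +_) (des-δ b)) (+-comm (des α) b)))) pd

  decreasingFirst⇒¬indec : ∀ {k n a w} → DecreasingFirst k n a w → ¬ Indec w
  decreasingFirst⇒¬indec {a = a} (x ∷ β , _ , refl) = indec⇒no-prefix (s≤s z≤n) (δ-perm (suc a))

  decreasingLast⇒¬indec : ∀ {n b w} → DecreasingLast n b w → ¬ Indec w
  decreasingLast⇒¬indec (α , (q , _ , _ , i , _) , refl) = indec⇒no-prefix (inc⇒1≤ q i) q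

  decreasingFirst-unique : ∀ {k n a a′ w} → DecreasingFirst k n a w → DecreasingFirst k n a′ w → a ≡ a′
  decreasingFirst-unique {a = a} {a′} (_ , _ , eq) (_ , _ , eq′) = suc-injective (proj₁ (∷-injective
    (first-block-unique (s≤s z≤n) (s≤s z≤n) (δ-perm (suc a)) (δ-perm (suc a′))
      (δ-indec (suc a)) (δ-indec (suc a′)) (trans (sym eq) eq′))))

  decreasingLast-unique : ∀ {n b b′ w} → b < n → b′ < n → DecreasingLast n b w → DecreasingLast n b′ w → b ≡ b′
  decreasingLast-unique b<n b′<n (α , (q , _ , ind , i , _) , eq) (α′ , (q′ , _ , ind′ , i′ , _) , eq′)
    with first-block-unique (inc⇒1≤ q i) (inc⇒1≤ q′ i′) q q′ (indec⁻ α ind) (indec⁻ α′ ind′) (trans (sym eq) eq′)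
  -- Equal first blocks have equal sizes n - (b + 1) and n - (b′ + 1); both subtractions are
  -- genuine, so they can be cancelled.
  ... | refl = suc-injective (∸-cancelˡ-≡ b<n b′<n (trans (sym (perm-length q)) (perm-length q′)))

  decreasing-disjoint : ∀ {k n a b w} → DecreasingFirst k n a w → DecreasingLast n b w → ⊥
  decreasing-disjoint {a = a} (_ , _ , eq) (α , (q , _ , ind , i , _) , eq′)
    with first-block-unique (s≤s z≤n) (inc⇒1≤ q i) (δ-perm (suc a)) q (δ-indec (suc a)) (indec⁻ α ind)
      (trans (sym eq) eq′)
  ... | refl = δ-noninc (suc a) i

  decreasingFirst-intro : ∀ {k n w} → p (des w) ≡ true → (D : Decomposition n w) →
    ¬ Inc 2 0 (Decomposition.α D) → ¬ Inc k 0 (Decomposition.β D) →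
    ∃ λ a → a < n × DecreasingFirst k n a w
  decreasingFirst-intro {k} pd (decomp {a} {c} α β refl α-perm β-perm _ refl) nα nβ
    with noninc⇒δ (suc a) α-perm (nα ∘ inc-weaken z≤n)
  ... | refl = a , m≤m+n (suc a) (suc c) ,
    β , (subst (λ m → Perm m β) (sym (m+n∸m≡n a (suc c))) β-perm , nβ , nonempty β-perm ,
      trans (cong p (sym (trans (des-⊕ α-perm β-perm) (cong (_+ des β) (des-δ a))))) pd) , refl
    where
    nonempty : ∀ {β} → Perm (suc c) β → null β ≡ false
    nonempty {[]} q with () ← perm-length q
    nonempty {_ ∷ _} q = refl

  decreasingLast-intro : ∀ {n w} → p (des w) ≡ true → (D : Decomposition n w) →
    ¬ Inc 3 0 (Decomposition.α D) → Inc 2 0 (Decomposition.α D) → ¬ Inc 2 0 (Decomposition.β D) →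
    ∃ λ b → b < n × DecreasingLast n b w
  decreasingLast-intro pd (decomp {a} {c} α β refl α-perm β-perm α-indec refl) n3 y2 nβ
    with noninc⇒δ (suc c) β-perm (nβ ∘ inc-weaken z≤n)
  ... | refl = c , m≤n+m (suc c) (suc a) , α , (subst (λ m → Perm m α) (sym size≡) α-perm , n3 , indec⁺ α-perm α-indec , y2 ,
      trans (cong p (sym (trans (des-⊕ α-perm β-perm)
        (trans (cong (des α +_) (des-δ c)) (+-comm (des α) c))))) pd) ,
    cong (λ m → α ++ map (m +_) (δ (suc c))) (sym size≡)
    where
    size≡ : suc a + suc c ∸ suc c ≡ suc a
    size≡ = m+n∸n≡m (suc a) (suc c)

  -- Each summand contains an increasing subsequence of length 1. Hence `α` avoids 123, and `β`
  -- avoids 12 if `α` contains 12; otherwise `α` is decreasing and `β` need only avoid 123.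
  split-1234 : ∀ {n w} → Avoiding 4 (suc n) w → Indecomposable 4 (suc n) w ⊎
    (∃ λ a → a < suc n × DecreasingFirst 3 (suc n) a w) ⊎ (∃ λ b → b < suc n × DecreasingLast (suc n) b w)
  split-1234 av@(q , n4 , pd) with decompose q
  ... | inj₁ ind = inj₁ (av , indec⁺ q ind)
  ... | inj₂ D@(decomp α β _ α-perm β-perm _ refl) with inc? 2 0 α
  ...   | yes i = inj₂ (inj₂ (decreasingLast-intro pd D
            (λ j → n4 (inc-⊕⁺ α-perm β-perm j (perm⇒inc-1 β-perm))) i
            (λ j → n4 (inc-⊕⁺ α-perm β-perm i j))))
  ...   | no ni = inj₂ (inj₁ (decreasingFirst-intro pd D ni
            (λ j → n4 (inc-⊕⁺ α-perm β-perm (perm⇒inc-1 α-perm) j))))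

  split-123 : ∀ {n w} → Avoiding 3 (suc n) w → Indecomposable 3 (suc n) w ⊎
    (∃ λ a → a < suc n × DecreasingFirst 2 (suc n) a w)
  split-123 av@(q , n3 , pd) with decompose q
  ... | inj₁ ind = inj₁ (av , indec⁺ q ind)
  ... | inj₂ D@(decomp α β _ α-perm β-perm _ refl) = inj₂ (decreasingFirst-intro pd D
            (λ j → n3 (inc-⊕⁺ α-perm β-perm j (perm⇒inc-1 β-perm)))
            (λ j → n3 (inc-⊕⁺ α-perm β-perm (perm⇒inc-1 α-perm) j)))

  -- A decreasing summand of size a + 1 has a descents and so contributes x^(a+1) q^a, a term of
  -- x/(1-xq); this is the shift by `a` here and by `b` in `lastCount`. Testing `null` removes the
  -- constant term of A, as in A - 1.
  firstCount : List ℕ → ℕ → ℕ → ℕ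
  firstCount τ a c = count (λ β → avoids β τ ∧ not (null β) ∧ p (a + des β)) (perms c)

  lastCount : ℕ → ℕ → ℕ
  lastCount b c = count (λ α → avoids α p123 ∧ indec α ∧ contains α p12 ∧ p (b + des α)) (perms c)

  module _ {τ : List ℕ} (inc : AllPairs _<_ τ) (n : ℕ) where

    card-avoiding : Card (Avoiding (length τ) n) (count (λ π → avoids π τ ∧ p (des π)) (perms n))
    card-avoiding = card-cong
      (λ {w} (q , e) → q , avoids⁻ inc w (proj₁ (∧⁻ e)) , proj₂ (∧⁻ {avoids w τ} e))
      (λ {w} (q , nw , pd) → q , ∧⁺ (avoids⁺ inc w nw) pd)
      (card-perms n _)

    card-indecomposable : Card (Indecomposable (length τ) n)
      (count (λ π → avoids π τ ∧ indec π ∧ p (des π)) (perms n))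
    card-indecomposable = card-cong
      (λ {w} (q , e) → let e′ = ∧⁻ {indec w} (proj₂ (∧⁻ {avoids w τ} e)) in
        (q , avoids⁻ inc w (proj₁ (∧⁻ e)) , proj₂ e′) , proj₁ e′)
      (λ {w} ((q , nw , pd) , ind) → q , ∧⁺ (avoids⁺ inc w nw) (∧⁺ ind pd))
      (card-perms n _)

    card-decreasingFirst : ∀ a → Card (DecreasingFirst (length τ) n a) (firstCount τ a (n ∸ suc a))
    card-decreasingFirst a = card-image (λ β → δ (suc a) ++ map (suc a +_) β)
      (λ eq → map-injective (λ {x} {y} → +-cancelˡ-≡ (suc a) x y) (++-cancelˡ (δ (suc a)) _ _ eq))
      (card-cong
        (λ {β} (q , e) → let e′ = ∧⁻ {not (null β)} (proj₂ (∧⁻ {avoids β τ} e)) in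
          q , avoids⁻ inc β (proj₁ (∧⁻ e)) , not-injective (proj₁ e′) , proj₂ e′)
        (λ {β} (q , nβ , ne , pd) → q , ∧⁺ (avoids⁺ inc β nβ) (∧⁺ (cong not ne) pd))
        (card-perms (n ∸ suc a) _))

  Last : ℕ → ℕ → List ℕ → Set
  Last c b α = Perm c α × ¬ Inc 3 0 α × indec α ≡ true × Inc 2 0 α × p (b + des α) ≡ true

  card-last : ∀ c b → Card (Last c b) (lastCount b c)
  card-last c b = card-cong
    (λ {α} (q , e) →
      let e₁ = ∧⁻ {avoids α p123} e
          e₂ = ∧⁻ {indec α} (proj₂ e₁)
          e₃ = ∧⁻ {contains α p12} (proj₂ e₂)
      in q , avoids⁻ p123-inc α (proj₁ e₁) , proj₁ e₂ , contains⁻ p12-inc α (proj₁ e₃) , proj₂ e₃)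
    (λ {α} (q , nα , ind , i , pd) → q ,
      ∧⁺ (avoids⁺ p123-inc α nα) (∧⁺ ind (∧⁺ (contains⁺ p12-inc α i) pd)))
    (card-perms c _)

  card-decreasingLast : ∀ n b → Card (DecreasingLast n b) (lastCount b (n ∸ suc b))
  card-decreasingLast n b = card-image (λ α → α ++ map (n ∸ suc b +_) (δ (suc b)))
    (++-cancelʳ _ _ _) (card-last (n ∸ suc b) b)

  count-1234 : ∀ m → let n = suc m in
    count (λ π → avoids π p1234 ∧ p (des π)) (perms n) ≡
    count (λ π → avoids π p1234 ∧ indec π ∧ p (des π)) (perms n) +
    (sumBelow (λ a → firstCount p123 a (n ∸ suc a)) n + sumBelow (λ b → lastCount b (n ∸ suc b)) n)
  count-1234 m = card-unique (card-avoiding p1234-inc n) (card-cong merge split-1234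
    (card-⊎ (λ { (_ , ind) (inj₁ (a , a<n , x)) → decreasingFirst⇒¬indec {n = n} x (indec⁻ _ ind)
               ; (_ , ind) (inj₂ (b , b<n , y)) → decreasingLast⇒¬indec {n} y (indec⁻ _ ind) })
      (card-indecomposable p1234-inc n)
      (card-⊎ (λ (_ , _ , x) (_ , _ , y) → decreasing-disjoint {n = n} x y)
        (card-Σ n (λ _ _ → decreasingFirst-unique {n = n}) (λ a _ → card-decreasingFirst p123-inc n a))
        (card-Σ n (decreasingLast-unique {n}) (λ b _ → card-decreasingLast n b)))))
    where
    n = suc m
    merge : ∀ {w} → _ → Avoiding 4 n w
    merge (inj₁ (av , _)) = av
    merge (inj₂ (inj₁ (a , a<n , x))) = decreasingFirst⇒avoiding {n = n} a<n x
    merge (inj₂ (inj₂ (b , b<n , y))) = decreasingLast⇒avoiding {n} b<n y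

  count-123 : ∀ m → let n = suc m in
    count (λ π → avoids π p123 ∧ p (des π)) (perms n) ≡
    count (λ π → avoids π p123 ∧ indec π ∧ p (des π)) (perms n) +
    sumBelow (λ a → firstCount p12 a (n ∸ suc a)) n
  count-123 m = card-unique (card-avoiding p123-inc n) (card-cong merge split-123
    (card-⊎ (λ { (_ , ind) (a , a<n , x) → decreasingFirst⇒¬indec {n = n} x (indec⁻ _ ind) })
      (card-indecomposable p123-inc n)
      (card-Σ n (λ _ _ → decreasingFirst-unique {n = n}) (λ a _ → card-decreasingFirst p12-inc n a))))
    where
    n = suc m
    merge : ∀ {w} → _ → Avoiding 3 n w
    merge (inj₁ (av , _)) = av
    merge (inj₂ (a , a<n , x)) = decreasingFirst⇒avoiding {n = n} a<n x

  -- The decreasing word is the only indecomposable avoider of 123 without a 12, and it has m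
  -- descents: this is the correction x/(1-xq) subtracted from the series I of 123.
  indecomposable-split : ∀ m →
    count (λ π → avoids π p123 ∧ indec π ∧ p (des π)) (perms (suc m)) ≡
    lastCount 0 (suc m) + (if p m then 1 else 0)
  indecomposable-split m = card-unique (card-indecomposable p123-inc (suc m))
    (card-cong merge split
      (card-⊎ (λ { (_ , _ , _ , i , _) (refl , _) → δ-noninc (suc m) i }) (card-last (suc m) 0) decreasing))
    where
    merge : ∀ {w} → Last (suc m) 0 w ⊎ (w ≡ δ (suc m) × p m ≡ true) → Indecomposable 3 (suc m) w
    merge (inj₁ (q , n3 , ind , _ , pd)) = (q , n3 , pd) , ind
    merge (inj₂ (refl , pm)) = (δ-perm (suc m) , δ-noninc (suc m) ∘ inc-shorten ,
      trans (cong p (des-δ m)) pm) , indec⁺ (δ-perm (suc m)) (δ-indec (suc m))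
    split : ∀ {w} → Indecomposable 3 (suc m) w → Last (suc m) 0 w ⊎ (w ≡ δ (suc m) × p m ≡ true)
    split {w} ((q , n3 , pd) , ind) with inc? 2 0 w
    ... | yes i = inj₁ (q , n3 , ind , i , pd)
    ... | no ni with noninc⇒δ (suc m) q (ni ∘ inc-weaken z≤n)
    ...   | refl = inj₂ (refl , trans (cong p (sym (des-δ m))) pd)
    decreasing : Card (λ w → w ≡ δ (suc m) × p m ≡ true) (if p m then 1 else 0)
    decreasing with p m
    ... | true = card-singleton (δ (suc m)) (refl , refl) proj₁
    ... | false = card-empty λ ()

-- Power series

open import Data.Integer using (ℤ; +_; _-_)
import Data.Integer as ℤ
import Data.Integer.Properties as ℤ
import Data.Integer.Tactic.RingSolver as ℤ-Solver

sumBelow-cong : ∀ {f g} n → (∀ i → i < n → f i ≡ g i) → sumBelow f n ≡ sumBelow g n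
sumBelow-cong zero h = refl
sumBelow-cong (suc n) h = cong₂ _+_ (sumBelow-cong n (λ i i<n → h i (m<n⇒m<1+n i<n))) (h n ≤-refl)

sumBelow-front : ∀ f n → sumBelow f (suc n) ≡ f 0 + sumBelow (f ∘ suc) n
sumBelow-front f zero = sym (+-identityʳ (f 0))
sumBelow-front f (suc n) = trans (cong (_+ f (suc n)) (sumBelow-front f n)) (+-assoc (f 0) _ _)

-- Passes from summing over the size of one summand to summing over the size of the other.
sumBelow-reverse : ∀ f n → sumBelow (λ i → f (n ∸ suc i)) n ≡ sumBelow f n
sumBelow-reverse f zero = refl
sumBelow-reverse f (suc n) = trans (sumBelow-front (λ i → f (n ∸ i)) n)
  (trans (cong (_+_ (f n)) (sumBelow-reverse f n)) (+-comm (f n) _))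

sumBelow-+ : ∀ f g n → sumBelow (λ i → f i + g i) n ≡ sumBelow f n + sumBelow g n
sumBelow-+ f g zero = refl
sumBelow-+ f g (suc n) rewrite sumBelow-+ f g n = l (sumBelow f n) (sumBelow g n) (f n) (g n)
  where
  l : ∀ a b c d → a + b + (c + d) ≡ a + c + (b + d)
  l = solve-∀

sumTo-init : ∀ {h : ℕ → ℤ} {k} n → (∀ i → i ≤ n → h i ≡ + k i) → sumTo h n ≡ + sumBelow k (suc n)
sumTo-init zero h = h 0 z≤n
sumTo-init (suc n) h = cong₂ ℤ._+_ (sumTo-init n (λ i i≤n → h i (m≤n⇒m≤1+n i≤n))) (h (suc n) ≤-refl)

sumTo-tail : ∀ {h : ℕ → ℤ} {k} n → h 0 ≡ + 0 → (∀ i → i < n → h (suc i) ≡ + k i) → sumTo h n ≡ + sumBelow k n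
sumTo-tail zero h₀ _ = h₀
sumTo-tail (suc n) h₀ h = cong₂ ℤ._+_ (sumTo-tail n h₀ (λ i i<n → h i (m<n⇒m<1+n i<n))) (h n ≤-refl)

sumTo-zero : ∀ {h : ℕ → ℤ} n → (∀ i → i ≤ n → h i ≡ + 0) → sumTo h n ≡ + 0
sumTo-zero zero h = h 0 z≤n
sumTo-zero (suc n) h = cong₂ ℤ._+_ (sumTo-zero n (λ i i≤n → h i (m≤n⇒m≤1+n i≤n))) (h (suc n) ≤-refl)

≡ᵇ-false : ∀ {m n} → m ≢ n → (m ≡ᵇ n) ≡ false
≡ᵇ-false {m} {n} ne = ≢true⇒≡false (ne ∘ ≡ᵇ⇒≡ m n ∘ ≡⇒T)

≡ᵇ-true : ∀ n → (n ≡ᵇ n) ≡ true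
≡ᵇ-true n = T⇒≡ (≡⇒≡ᵇ n n refl)

indicator : ℕ → ℕ → ℤ
indicator a b = if a ≡ᵇ b then + 1 else + 0

indicator-≢ : ∀ {a b} (g : ℤ) → a ≢ b → indicator a b ℤ.* g ≡ + 0
indicator-≢ g ne rewrite ≡ᵇ-false ne = ℤ.*-zeroˡ g

sumTo-indicator : ∀ a (g : ℕ → ℤ) i → a ≤ i → sumTo (λ b → indicator a b ℤ.* g b) i ≡ g a
sumTo-indicator zero g zero z≤n = ℤ.*-identityˡ (g 0)
sumTo-indicator a g (suc i) a≤ with m≤n⇒m<n∨m≡n a≤
... | inj₁ (s≤s a≤i) = trans
  (cong₂ ℤ._+_ (sumTo-indicator a g i a≤i) (indicator-≢ (g (suc i)) (<⇒≢ (s≤s a≤i))))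
  (ℤ.+-identityʳ (g a))
... | inj₂ refl = trans
  (cong₂ ℤ._+_ (sumTo-zero i (λ b b≤i → indicator-≢ (g b) (<⇒≢ (s≤s b≤i) ∘ sym)))
    (trans (cong (λ e → (if e then + 1 else + 0) ℤ.* g (suc i)) (≡ᵇ-true i)) (ℤ.*-identityˡ (g (suc i)))))
  (ℤ.+-identityˡ (g (suc i)))

-- The coefficient of x^(a+1) in x/(1-xq) is q^a, so the inner sum keeps only b = a. If a > i
-- nothing is kept, which `miss` matches; the term at x^0 vanishes.
gxq-⊛₂ : ∀ (G : Ser2) (k : ℕ → ℕ) n i →
  (∀ a → a ≤ i → G (n ∸ suc a) (i ∸ a) ≡ + k a) → (∀ a → i < a → k a ≡ 0) →
  (gxq ⊛₂ G) n i ≡ + sumBelow k n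
gxq-⊛₂ G k n i hit miss = sumTo-tail n
  (sumTo-zero i (λ b _ → ℤ.*-zeroˡ (G n (i ∸ b))))
  coefficient
  where
  coefficient : ∀ a → a < n → sumTo (λ b → gxq (suc a) b ℤ.* G (n ∸ suc a) (i ∸ b)) i ≡ + k a
  coefficient a _ with a ≤? i
  ... | yes a≤i = trans (sumTo-indicator a (λ b → G (n ∸ suc a) (i ∸ b)) i a≤i) (hit a a≤i)
  ... | no a≰i = trans
    (sumTo-zero i (λ b b≤i → indicator-≢ (G (n ∸ suc a) (i ∸ b)) (λ eq → a≰i (subst (_≤ i) (sym eq) b≤i))))
    (cong +_ (sym (miss a (≰⇒> a≰i))))

count-cong : ∀ {A : Set} {p q : A → Bool} xs → (∀ {x} → x ∈ xs → p x ≡ q x) → count p xs ≡ count q xs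
count-cong [] _ = refl
count-cong {p = p} {q} (x ∷ xs) h rewrite h (here refl) | count-cong xs (h ∘ there) = refl

count-none : ∀ {A : Set} {p : A → Bool} xs → (∀ x → p x ≡ false) → count p xs ≡ 0
count-none [] _ = refl
count-none (x ∷ xs) h rewrite h x = count-none xs h

+-≡ᵇ : ∀ {a i} d → a ≤ i → (a + d ≡ᵇ i) ≡ (d ≡ᵇ i ∸ a)
+-≡ᵇ d z≤n = refl
+-≡ᵇ d (s≤s a≤i) = +-≡ᵇ d a≤i

+-≢ᵇ : ∀ {a i} d → i < a → (a + d ≡ᵇ i) ≡ false
+-≢ᵇ {a} d i<a = ≡ᵇ-false (<⇒≢ (≤-trans i<a (m≤m+n a d)) ∘ sym)

not-null : ∀ {c β} → β ∈ perms (suc c) → not (null β) ≡ true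
not-null {c} {[]} β∈ with () ← perm-length (∈-perms⁻ (suc c) β∈)
not-null {c} {_ ∷ _} _ = refl

firstCount-suc : ∀ p τ a c → firstCount p τ a (suc c) ≡ count (λ β → avoids β τ ∧ p (a + des β)) (perms (suc c))
firstCount-suc p τ a c = count-cong (perms (suc c)) λ {β} β∈ →
  cong (λ e → avoids β τ ∧ e ∧ p (a + des β)) (not-null {c} β∈)

firstCount-hit : ∀ {a i} c → a ≤ i →
  (Aser2 p123 ⊖₂ one2) c (i ∸ a) ≡ + firstCount (_≡ᵇ i) p123 a c
firstCount-hit {a} {i} zero _ = ℤ.+-inverseʳ (one2 0 (i ∸ a))
firstCount-hit {a} {i} (suc c) a≤i = trans (ℤ.+-identityʳ _) (cong +_ (sym
  (trans (firstCount-suc (_≡ᵇ i) p123 a c)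
    (count-cong (perms (suc c)) λ {β} _ → cong (avoids β p123 ∧_) (+-≡ᵇ (des β) a≤i)))))

firstCount-miss : ∀ {a i} c → i < a → firstCount (_≡ᵇ i) p123 a c ≡ 0
firstCount-miss c i<a = count-none (perms c) λ β → trans
  (cong (λ e → avoids β p123 ∧ not (null β) ∧ e) (+-≢ᵇ (des β) i<a))
  (trans (cong (avoids β p123 ∧_) (∧-zeroʳ (not (null β)))) (∧-zeroʳ (avoids β p123)))

lastCount-hit : ∀ {a i} c → a ≤ i →
  (Iser2 p123 ⊖₂ gxq) c (i ∸ a) ≡ + lastCount (_≡ᵇ i) a c
-- Both sides are 0, since `indec` rejects the empty word.
lastCount-hit zero _ = refl
lastCount-hit {a} {i} (suc c) a≤i = begin
    + Icnt p123 (suc c) j - indicator c j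
      ≡⟨ cong₂ (λ x y → + x - y) (indecomposable-split (_≡ᵇ j) c) (indicator-ℕ c j) ⟩
    + (lastCount (_≡ᵇ j) 0 (suc c) + r) - + r
      ≡⟨ l (+ lastCount (_≡ᵇ j) 0 (suc c)) (+ r) ⟩
    + lastCount (_≡ᵇ j) 0 (suc c)
      ≡⟨ cong +_ (count-cong (perms (suc c)) λ {α} _ →
          cong (λ e → avoids α p123 ∧ indec α ∧ contains α p12 ∧ e) (sym (+-≡ᵇ (des α) a≤i))) ⟩
    + lastCount (_≡ᵇ i) a (suc c) ∎
  where
  open ≡-Reasoning
  j = i ∸ a
  r = if c ≡ᵇ j then 1 else 0
  indicator-ℕ : ∀ c j → indicator c j ≡ + (if c ≡ᵇ j then 1 else 0)
  indicator-ℕ c j with c ≡ᵇ j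
  ... | true = refl
  ... | false = refl
  l : ∀ x y → x ℤ.+ y - y ≡ x
  l = ℤ-Solver.solve-∀

lastCount-miss : ∀ {a i} c → i < a → lastCount (_≡ᵇ i) a c ≡ 0
lastCount-miss c i<a = count-none (perms c) λ α → trans
  (cong (λ e → avoids α p123 ∧ indec α ∧ contains α p12 ∧ e) (+-≢ᵇ (des α) i<a))
  (trans (cong (λ e → avoids α p123 ∧ indec α ∧ e) (∧-zeroʳ (contains α p12)))
    (trans (cong (avoids α p123 ∧_) (∧-zeroʳ (indec α))) (∧-zeroʳ (avoids α p123))))

bivariate : ∀ n i → Aser2 p1234 n i ≡
  (one2 ⊕₂ Iser2 p1234 ⊕₂ gxq ⊛₂ (Aser2 p123 ⊖₂ one2) ⊕₂ gxq ⊛₂ (Iser2 p123 ⊖₂ gxq)) n i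
bivariate n i = trans (go n) (sym (cong₂ (λ x y → one2 n i ℤ.+ Iser2 p1234 n i ℤ.+ x ℤ.+ y)
  (gxq-⊛₂ (Aser2 p123 ⊖₂ one2) (first n) n i (λ a → firstCount-hit (n ∸ suc a)) (λ a → firstCount-miss (n ∸ suc a)))
  (gxq-⊛₂ (Iser2 p123 ⊖₂ gxq) (last n) n i (λ a → lastCount-hit (n ∸ suc a)) (λ a → lastCount-miss (n ∸ suc a)))))
  where
  first last : ℕ → ℕ → ℕ
  first n a = firstCount (_≡ᵇ i) p123 a (n ∸ suc a)
  last n a = lastCount (_≡ᵇ i) a (n ∸ suc a)
  l : ∀ x y z → x ℤ.+ (y ℤ.+ z) ≡ + 0 ℤ.+ x ℤ.+ y ℤ.+ z
  l = ℤ-Solver.solve-∀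
  l₀ : ∀ x → x ≡ x ℤ.+ + 0 ℤ.+ + 0 ℤ.+ + 0
  l₀ = ℤ-Solver.solve-∀
  go : ∀ n → Aser2 p1234 n i ≡ one2 n i ℤ.+ Iser2 p1234 n i ℤ.+ + sumBelow (first n) n ℤ.+ + sumBelow (last n) n
  go zero = l₀ (one2 0 i)
  go (suc m) = trans (cong +_ (count-1234 (_≡ᵇ i) m))
    (l (+ Icnt p1234 (suc m) i) (+ sumBelow (first (suc m)) (suc m)) (+ sumBelow (last (suc m)) (suc m)))

-- Specialisation at q = 1

always : ℕ → Bool
always _ = true

-- The first two hold the coefficients of C(x) - 1 and x/(1-x). As `always` ignores its argument,
-- `lastTotal` agrees with `lastCount always b` for every b. The sum stops below n, so
-- `triangular n` is n(n-1)/2.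
catalan⁺ positive lastTotal triangular : ℕ → ℕ
catalan⁺ zero = 0
catalan⁺ (suc c) = catalan (suc c)
positive zero = 0
positive (suc c) = 1
lastTotal c = lastCount always 0 c
triangular = sumBelow id

avoiders-123 : ∀ c → count (λ π → avoids π p123 ∧ true) (perms c) ≡ catalan c
avoiders-123 c = trans (card-unique (card-avoiding always p123-inc c)
  (card-cong (λ (q , n) → q , n , refl) (λ (q , n , _) → q , n) (card-123 c))) (b-catalan c)

avoiders-12 : ∀ c → count (λ π → avoids π p12 ∧ true) (perms c) ≡ 1
avoiders-12 c = card-unique (card-avoiding always p12-inc c)
  (card-singleton (δ c) (δ-perm c , δ-noninc c , refl) (λ (q , n , _) → noninc⇒δ c q (n ∘ inc-weaken z≤n)))

firstCount-123 : ∀ a c → firstCount always p123 a c ≡ catalan⁺ c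
firstCount-123 a zero = refl
firstCount-123 a (suc c) = trans (firstCount-suc always p123 a c) (avoiders-123 (suc c))

firstCount-12 : ∀ a c → firstCount always p12 a c ≡ positive c
firstCount-12 a zero = refl
firstCount-12 a (suc c) = trans (firstCount-suc always p12 a c) (avoiders-12 (suc c))

sumBelow-positive : ∀ m → sumBelow positive (suc m) ≡ m
sumBelow-positive zero = refl
sumBelow-positive (suc m) = trans (cong (_+ 1) (sumBelow-positive m)) (+-comm m 1)

-- Among the avoiders of 123 of size m + 1, the m sums of two decreasing words and the decreasing
-- word itself are not counted by `lastTotal`: m + 1 words in all.
lastTotal-catalan : ∀ c → lastTotal c + c ≡ catalan⁺ c
lastTotal-catalan zero = refl
lastTotal-catalan (suc m) = begin
    lastTotal (suc m) + suc m
      ≡⟨ +-assoc (lastTotal (suc m)) 1 m ⟨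
    lastTotal (suc m) + 1 + m
      ≡⟨ cong₂ _+_ (indecomposable-split always m)
          (trans (sumBelow-cong (suc m) (λ a _ → firstCount-12 a (m ∸ a)))
            (trans (sumBelow-reverse positive (suc m)) (sumBelow-positive m))) ⟨
    count (λ π → avoids π p123 ∧ indec π ∧ true) (perms (suc m)) +
      sumBelow (λ a → firstCount always p12 a (m ∸ a)) (suc m)
      ≡⟨ count-123 always m ⟨
    count (λ π → avoids π p123 ∧ true) (perms (suc m))
      ≡⟨ avoiders-123 (suc m) ⟩
    catalan (suc m) ∎
  where open ≡-Reasoning

sumBelow-catalan⁺ : ∀ m → sumBelow catalan⁺ (suc m) + 1 ≡ sumBelow catalan (suc m)
sumBelow-catalan⁺ zero = refl
sumBelow-catalan⁺ (suc m) = trans (l (sumBelow catalan⁺ (suc m)) (catalan (suc m)))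
  (cong (_+ catalan (suc m)) (sumBelow-catalan⁺ m))
  where
  l : ∀ x y → x + y + 1 ≡ x + 1 + y
  l = solve-∀

-- Write S for the sum of the Catalan numbers below n, less 1. The decomposable words with
-- decreasing first block number S, and the others S - n(n-1)/2. Terms are moved across to avoid
-- subtraction.
univariate : ∀ m → let n = suc m in
  E n + (triangular n + 2) ≡ Icnt1 p1234 n + 2 * sumBelow catalan n
univariate m = begin
    E n + (triangular n + 2)
      ≡⟨ cong (_+ (triangular n + 2)) total ⟩
    Icnt1 p1234 n + (S + Y) + (triangular n + 2)
      ≡⟨ l₁ (Icnt1 p1234 n) S Y (triangular n) ⟩
    Icnt1 p1234 n + (S + (Y + triangular n) + 2)
      ≡⟨ cong (λ x → Icnt1 p1234 n + (S + x + 2)) Y+t ⟩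
    Icnt1 p1234 n + (S + S + 2)
      ≡⟨ l₂ (Icnt1 p1234 n) S ⟩
    Icnt1 p1234 n + 2 * (S + 1)
      ≡⟨ cong (λ x → Icnt1 p1234 n + 2 * x) (sumBelow-catalan⁺ m) ⟩
    Icnt1 p1234 n + 2 * sumBelow catalan n ∎
  where
  open ≡-Reasoning
  n = suc m
  S = sumBelow catalan⁺ n
  Y = sumBelow lastTotal n
  Y+t : Y + triangular n ≡ S
  Y+t = trans (sym (sumBelow-+ lastTotal id n)) (sumBelow-cong n (λ c _ → lastTotal-catalan c))
  total : E n ≡ Icnt1 p1234 n + (S + Y)
  total = begin
    E n
      ≡⟨ count-cong (perms n) (λ {π} _ → sym (∧-identityʳ (avoids π p1234))) ⟩
    count (λ π → avoids π p1234 ∧ true) (perms n)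
      ≡⟨ count-1234 always m ⟩
    count (λ π → avoids π p1234 ∧ indec π ∧ true) (perms n) +
      (sumBelow (λ a → firstCount always p123 a (n ∸ suc a)) n + sumBelow (λ b → lastTotal (n ∸ suc b)) n)
      ≡⟨ cong₂ _+_ (count-cong (perms n) (λ {π} _ → cong (avoids π p1234 ∧_) (∧-identityʳ (indec π))))
          (cong₂ _+_ (trans (sumBelow-cong n (λ a _ → firstCount-123 a (n ∸ suc a))) (sumBelow-reverse catalan⁺ n))
                     (sumBelow-reverse lastTotal n)) ⟩
    Icnt1 p1234 n + (S + Y) ∎
  l₁ : ∀ i s y t → i + (s + y) + (t + 2) ≡ i + (s + (y + t) + 2)
  l₁ = solve-∀
  l₂ : ∀ i s → i + (s + s + 2) ≡ i + 2 * (s + 1)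
  l₂ = solve-∀

univariate-ℤ : ∀ m → let n = suc m in
  + Icnt1 p1234 n ≡ (+ E n - + (2 * sumBelow catalan n)) ℤ.+ + (triangular n + 2)
univariate-ℤ m = sym (begin
    (e - c) ℤ.+ t ≡⟨ l₁ e c t ⟩
    (e ℤ.+ t) - c ≡⟨ cong (λ x → + x - c) (univariate m) ⟩
    (i ℤ.+ c) - c ≡⟨ l₂ i c ⟩
    i             ∎)
  where
  open ≡-Reasoning
  e = + E (suc m)
  c = + (2 * sumBelow catalan (suc m))
  t = + (triangular (suc m) + 2)
  i = + Icnt1 p1234 (suc m)
  l₁ : ∀ e c t → (e - c) ℤ.+ t ≡ (e ℤ.+ t) - c
  l₁ = ℤ-Solver.solve-∀
  l₂ : ∀ i c → (i ℤ.+ c) - c ≡ i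
  l₂ = ℤ-Solver.solve-∀

triangular-double : ∀ n → triangular n * 2 + n ≡ n * n
triangular-double zero = refl
triangular-double (suc n) = trans (l (triangular n) n) (trans (cong (λ x → x + n + suc n) (triangular-double n)) (l′ n))
  where
  l : ∀ t n → (t + n) * 2 + suc n ≡ t * 2 + n + n + suc n
  l = solve-∀
  l′ : ∀ n → n * n + n + suc n ≡ suc n * suc n
  l′ = solve-∀

half : ∀ n → (n * n ∸ n + 4) / 2 ≡ triangular n + 2
half n = begin
    (n * n ∸ n + 4) / 2                     ≡⟨ cong (λ x → (x ∸ n + 4) / 2) (triangular-double n) ⟨
    (triangular n * 2 + n ∸ n + 4) / 2      ≡⟨ cong (λ x → (x + 4) / 2) (m+n∸n≡m (triangular n * 2) n) ⟩
    (triangular n * 2 + 4) / 2              ≡⟨ cong (_/ 2) (*-distribʳ-+ 2 (triangular n) 2) ⟨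
    ((triangular n + 2) * 2) / 2            ≡⟨ m*n/n≡m (triangular n + 2) 2 ⟩
    triangular n + 2                        ∎
  where open ≡-Reasoning

-- Multiplying by x/(1-x) takes partial sums, with the last term excluded because of the factor x.
gx-⊛ : ∀ {f : Ser1} {g} → (∀ a → f a ≡ + g a) → ∀ n → (gx ⊛ f) n ≡ + sumBelow g n
gx-⊛ {f} {g} h n = trans (sumTo-tail n (ℤ.*-zeroˡ (f n))
    (λ a _ → trans (ℤ.*-identityˡ (f (n ∸ suc a))) (h (n ∸ suc a))))
  (cong +_ (sumBelow-reverse g n))

-- The triple product associates to the left, so its last factor x/(1-x) stands on the right.
⊛-comm-gx : ∀ {f : Ser1} {g} → (∀ a → f a ≡ + g a) → ∀ n → (f ⊛ gx) n ≡ + sumBelow g n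
⊛-comm-gx {f} {g} h zero = ℤ.*-zeroʳ (f 0)
⊛-comm-gx {f} {g} h (suc m) = trans (cong₂ ℤ._+_
    (sumTo-init m (λ a a≤m → trans (cong (λ x → f a ℤ.* gx x) (+-∸-assoc 1 a≤m)) (trans (ℤ.*-identityʳ (f a)) (h a))))
    (trans (cong (λ x → f (suc m) ℤ.* gx x) (n∸n≡0 m)) (ℤ.*-zeroʳ (f (suc m)))))
  (ℤ.+-identityʳ _)

gx-positive : ∀ a → gx a ≡ + positive a
gx-positive zero = refl
gx-positive (suc a) = refl

gx² : ∀ n → (gx ⊛ gx) n ≡ + sumBelow positive n
gx² = gx-⊛ gx-positive

-- At x^(m+1) the cube of x/(1-x) has coefficient m(m-1)/2 and its square has m; together they give
-- m(m+1)/2.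
sumBelow²-positive : ∀ m → sumBelow (sumBelow positive) (suc m) + m ≡ triangular (suc m)
sumBelow²-positive m = cong (_+ m) (go m)
  where
  go : ∀ m → sumBelow (sumBelow positive) (suc m) ≡ triangular m
  go zero = refl
  go (suc m) = cong₂ _+_ (go m) (sumBelow-positive m)

generating-function : ∀ n → Iser1 p1234 n ≡
  (Eser ⊖ scal (+ 2) (gx ⊛ Cser) ⊕ gx ⊛ gx ⊛ gx ⊕ gx ⊛ gx ⊕ scal (+ 2) gx ⊖ one1) n
-- The constant term 1 of E cancels the final -1.
generating-function zero = refl
generating-function (suc m) = begin
    + Icnt1 p1234 n
      ≡⟨ univariate-ℤ m ⟩
    (+ E n - + (2 * s)) ℤ.+ + (triangular n + 2)
      ≡⟨ cong₂ (λ x y → (+ E n - x) ℤ.+ + (y + 2)) (ℤ.pos-* 2 s) (sym (sumBelow²-positive m)) ⟩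
    (+ E n - + 2 ℤ.* + s) ℤ.+ (+ t ℤ.+ + m ℤ.+ + 2)
      ≡⟨ l (+ E n) (+ s) (+ t) (+ m) ⟩
    -- The trailing 1 and 0 are the coefficients of `gx` and `one1` at a positive power of x.
    + E n - + 2 ℤ.* + s ℤ.+ + t ℤ.+ + m ℤ.+ + 2 ℤ.* + 1 - + 0
      ≡⟨ cong₂ (λ x y → + E n - + 2 ℤ.* x ℤ.+ y ℤ.+ + m ℤ.+ + 2 ℤ.* + 1 - + 0)
          (gx-⊛ {Cser} (λ _ → refl) n) (⊛-comm-gx {gx ⊛ gx} gx² n) ⟨
    + E n - + 2 ℤ.* (gx ⊛ Cser) n ℤ.+ (gx ⊛ gx ⊛ gx) n ℤ.+ + m ℤ.+ + 2 ℤ.* + 1 - + 0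
      ≡⟨ cong (λ x → + E n - + 2 ℤ.* (gx ⊛ Cser) n ℤ.+ (gx ⊛ gx ⊛ gx) n ℤ.+ x ℤ.+ + 2 ℤ.* + 1 - + 0)
          (trans (gx² n) (cong +_ (sumBelow-positive m))) ⟨
    + E n - + 2 ℤ.* (gx ⊛ Cser) n ℤ.+ (gx ⊛ gx ⊛ gx) n ℤ.+ (gx ⊛ gx) n ℤ.+ + 2 ℤ.* + 1 - + 0 ∎
  where
  open ≡-Reasoning
  n = suc m
  s = sumBelow catalan n
  t = sumBelow (sumBelow positive) n
  l : ∀ e s t m → (e - + 2 ℤ.* s) ℤ.+ (t ℤ.+ m ℤ.+ + 2) ≡
      e - + 2 ℤ.* s ℤ.+ t ℤ.+ m ℤ.+ + 2 ℤ.* + 1 - + 0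
  l = ℤ-Solver.solve-∀

theorem3p19 : (∀ n i → Aser2 p1234 n i
    ≡ (one2 ⊕₂ Iser2 p1234
    ⊕₂ gxq ⊛₂ (Aser2 p123 ⊖₂ one2)
    ⊕₂ gxq ⊛₂ (Iser2 p123 ⊖₂ gxq)) n i)
    × (∀ n → Iser1 p1234 n
    ≡ (Eser ⊖ scal (+ 2) (gx ⊛ Cser) ⊕ gx ⊛ gx ⊛ gx ⊕ gx ⊛ gx
    ⊕ scal (+ 2) gx ⊖ one1) n)
    × (Icnt1 p1234 1 ≡ 1)
    × (∀ n → 2 ≤ n →
    + Icnt1 p1234 n
    ≡ (+ E n - + (2 * sumBelow catalan n))
    Data.Integer.+ + ((n * n ∸ n Data.Nat.+ 4) / 2))
theorem3p19 = bivariate , generating-function , refl , closed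
  where
  closed : ∀ n → 2 ≤ n → + Icnt1 p1234 n ≡ (+ E n - + (2 * sumBelow catalan n)) ℤ.+ + ((n * n ∸ n + 4) / 2)
  closed (suc m) _ = trans (univariate-ℤ m)
    (cong (λ x → (+ E (suc m) - + (2 * sumBelow catalan (suc m))) ℤ.+ + x) (sym (half (suc m))))
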